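{- For every composition $p=(p_1,\ldots,p_\ell)$ of positive integers, let $B_p 1=B_{p_1}B_{p_2}\cdots B_{p_\ell}\,1$. Then $$B_p1\Big|_{q\to 1+q}\;=\;\sum_{\mu\vdash |p|} P_\mu(q)\,e_\mu[X]$$ for some polynomials $P_\mu(q)$ with nonnegative integer coefficients. Here $|p|=p_1+\cdots+p_\ell$.
   Context: For an integer $a\ge1$, the modified Hall–Littlewood operator $B_a$ acts on symmetric functions $F[X]$ (with coefficients in $\mathbb{Q}[q]$) by $$B_aF[X]=F\Big[X+\epsilon\frac{1-q}{z}\Big]\sum_{r\ge0}z^re_r[X]\Big|_{z^a},$$ where $|_{z^a}$ denotes taking the coefficient of $z^a$. The brackets denote plethystic substitution, and $\epsilon$ is the plethystic variable with $p_k[\epsilon]=(-1)^k$. Thus $p_k[X+\epsilon\frac{1-q}{z}]=p_k[X]+(-1)^k\frac{1-q^k}{z^k}$. Equivalently, $$B_a=\sum_{r,s\ge0}(-1)^sq^r\,e_{a+r+s}\,e_r^\perp h_s^\perp,$$ where $e_{a+r+s}$ acts by multiplication and $f^\perp$ is the adjoint of multiplication by $f$ under the Hall scalar product. The notation $|_{q\to 1+q}$ means substituting $1+q$ for $q$. -}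

module Defs where

open import Algebra.Bundles using (RawRing; CommutativeRing)
import Algebra.Definitions.RawSemiring as RawSemiringDefs
open import Data.Integer.Base using (+_)
open import Data.List.Base using (List; []; _∷_; map; foldr; concatMap; filter; replicate; _++_)
open import Data.List.Relation.Unary.Linked using (Linked; linked?)
open import Data.Nat.Base using (ℕ; zero; suc; _≥_)
open import Data.Nat.Properties using (_≥?_)
open import Data.Product.Base using (_,_)
import Data.Rational.Base as ℚ
open import Data.Vec.Base as Vec using (Vec; []; _∷_)
open import Level using (Level; 0ℓ)
open import Relation.Binary.Core using (Rel)
open import Relation.Binary.Structures using (IsEquivalence)

------------------------------------------------------------------------
-- Univariate polynomials over R, as coefficient lists with the constant
-- term first.  Trailing zeros are allowed, so equality is coefficientwise.

module Polynomial {c ℓ : Level} (R : RawRing c ℓ) where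

  private module R = RawRing R

  Poly : Set c
  Poly = List R.Carrier

  coeff : Poly → ℕ → R.Carrier
  coeff []      _       = R.0#
  coeff (a ∷ f) zero    = a
  coeff (a ∷ f) (suc n) = coeff f n

  infix 4 _≈ₚ_
  record _≈ₚ_ (f g : Poly) : Set ℓ where
    constructor coeffwise
    field
      coeff-≈ : ∀ n → coeff f n R.≈ coeff g n

  infixl 6 _+ₚ_
  infixl 7 _*ₚ_

  _+ₚ_ : Poly → Poly → Poly
  []      +ₚ g       = g
  (a ∷ f) +ₚ []      = a ∷ f
  (a ∷ f) +ₚ (b ∷ g) = (a R.+ b) ∷ (f +ₚ g)

  _*ₚ_ : Poly → Poly → Poly
  []      *ₚ g = []
  (a ∷ f) *ₚ g = map (a R.*_) g +ₚ (R.0# ∷ f *ₚ g)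

  constant : R.Carrier → Poly
  constant a = a ∷ []

  monomial : R.Carrier → ℕ → Poly
  monomial a n = replicate n R.0# ++ constant a

  rawRing : RawRing c ℓ
  rawRing = record
    { Carrier = Poly
    ; _≈_     = _≈ₚ_
    ; _+_     = _+ₚ_
    ; _*_     = _*ₚ_
    ; -_      = map R.-_
    ; 0#      = []
    ; 1#      = constant R.1#
    }

  infixr 9 _∘ₚ_
  _∘ₚ_ : Poly → Poly → Poly
  []      ∘ₚ g = []
  (a ∷ f) ∘ₚ g = constant a +ₚ g *ₚ (f ∘ₚ g)

------------------------------------------------------------------------

module ℚ[q] = Polynomial ℚ.+-*-rawRing

ℚ[q] : Set
ℚ[q] = ℚ[q].Poly

ℚ[q]-rawRing : RawRing 0ℓ 0ℓ
ℚ[q]-rawRing = ℚ[q].rawRing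

private module K = RawRing ℚ[q]-rawRing

q : ℚ[q]
q = ℚ[q].monomial ℚ.1ℚ 1

q→1+q : ℚ[q] → ℚ[q]
q→1+q f = f ℚ[q].∘ₚ (K.1# K.+ q)

-- Coefficient lists over ℕ: the polynomials with nonnegative integer
-- coefficients.
ℕ[q] : Set
ℕ[q] = List ℕ

fromℕ[q] : ℕ[q] → ℚ[q]
fromℕ[q] = map (λ n → + n ℚ./ 1)

------------------------------------------------------------------------
-- Symmetric functions over ℚ[q].  As ℚ ⊆ ℚ[q], they form the polynomial
-- ring ℚ[q][p₁, p₂, …] on the power sums, and plethystic substitution is
-- defined by its effect on these generators.  The polynomial ring is
-- presented as the free commutative ℚ[q]-algebra: expressions modulo the
-- congruence generated by the algebra axioms.

infixl 6 _⊕_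
infixl 7 _⊗_
infix  8 ⊖_

data Λ : Set where
  con  : ℚ[q] → Λ
  p₁₊_ : ℕ → Λ          -- p₁₊ k is the power sum of degree 1 + k
  _⊕_  : Λ → Λ → Λ
  _⊗_  : Λ → Λ → Λ
  ⊖_   : Λ → Λ

infix 4 _≈_

data _≈_ : Rel Λ 0ℓ where
  ≈-refl  : ∀ {F} → F ≈ F
  ≈-sym   : ∀ {F G} → F ≈ G → G ≈ F
  ≈-trans : ∀ {F G H} → F ≈ G → G ≈ H → F ≈ H

  con-cong : ∀ {f g} → f K.≈ g → con f ≈ con g
  ⊕-cong   : ∀ {F F′ G G′} → F ≈ F′ → G ≈ G′ → F ⊕ G ≈ F′ ⊕ G′
  ⊗-cong   : ∀ {F F′ G G′} → F ≈ F′ → G ≈ G′ → F ⊗ G ≈ F′ ⊗ G′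
  ⊖-cong   : ∀ {F F′} → F ≈ F′ → ⊖ F ≈ ⊖ F′

  con-+ : ∀ f g → con (f K.+ g) ≈ con f ⊕ con g
  con-* : ∀ f g → con (f K.* g) ≈ con f ⊗ con g

  ⊕-assoc     : ∀ F G H → (F ⊕ G) ⊕ H ≈ F ⊕ (G ⊕ H)
  ⊕-comm      : ∀ F G → F ⊕ G ≈ G ⊕ F
  ⊕-identityˡ : ∀ F → con K.0# ⊕ F ≈ F
  ⊖-inverseˡ  : ∀ F → (⊖ F) ⊕ F ≈ con K.0#
  ⊗-assoc     : ∀ F G H → (F ⊗ G) ⊗ H ≈ F ⊗ (G ⊗ H)
  ⊗-comm      : ∀ F G → F ⊗ G ≈ G ⊗ F
  ⊗-identityˡ : ∀ F → con K.1# ⊗ F ≈ F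
  ⊗-distribʳ  : ∀ F G H → (G ⊕ H) ⊗ F ≈ (G ⊗ F) ⊕ (H ⊗ F)

Λ-commutativeRing : CommutativeRing 0ℓ 0ℓ
Λ-commutativeRing = record
  { Carrier = Λ
  ; _≈_     = _≈_
  ; _+_     = _⊕_
  ; _*_     = _⊗_
  ; -_      = ⊖_
  ; 0#      = con K.0#
  ; 1#      = con K.1#
  ; isCommutativeRing = record
    { isRing = record
      { +-isAbelianGroup = record
        { isGroup = record
          { isMonoid = record
            { isSemigroup = record
              { isMagma = record
                { isEquivalence = ≈-equiv
                ; ∙-cong        = ⊕-cong
                }
              ; assoc = ⊕-assoc
              }
            ; identity = ⊕-identityˡ
                       , λ F → ≈-trans (⊕-comm F _) (⊕-identityˡ F)
            }
          ; inverse = ⊖-inverseˡ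
                    , λ F → ≈-trans (⊕-comm F _) (⊖-inverseˡ F)
          ; ⁻¹-cong = ⊖-cong
          }
        ; comm = ⊕-comm
        }
      ; *-cong     = ⊗-cong
      ; *-assoc    = ⊗-assoc
      ; *-identity = ⊗-identityˡ
                   , λ F → ≈-trans (⊗-comm F _) (⊗-identityˡ F)
      ; distrib    = (λ F G H → ≈-trans (⊗-comm F _)
                                (≈-trans (⊗-distribʳ F G H)
                                (⊕-cong (⊗-comm G F) (⊗-comm H F))))
                   , ⊗-distribʳ
      }
    ; *-comm = ⊗-comm
    }
  }
  where
  ≈-equiv : IsEquivalence _≈_
  ≈-equiv = record { refl = ≈-refl ; sym = ≈-sym ; trans = ≈-trans }

Λ-rawRing : RawRing 0ℓ 0ℓ
Λ-rawRing = CommutativeRing.rawRing Λ-commutativeRing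

0Λ 1Λ : Λ
0Λ = con K.0#
1Λ = con K.1#

sumΛ productΛ : List Λ → Λ
sumΛ     = foldr _⊕_ 0Λ
productΛ = foldr _⊗_ 1Λ

-- The ring homomorphism on Λ with prescribed values on coefficients and
-- on power sums (P k is the image of p of degree 1 + k).
module _ {c ℓ : Level} (A : RawRing c ℓ) where

  private module A = RawRing A

  extend : (ℚ[q] → A.Carrier) → (ℕ → A.Carrier) → Λ → A.Carrier
  extend C P (con f) = C f
  extend C P (p₁₊ k) = P k
  extend C P (F ⊕ G) = extend C P F A.+ extend C P G
  extend C P (F ⊗ G) = extend C P F A.* extend C P G
  extend C P (⊖ F)   = A.- extend C P F

_∣q→1+q : Λ → Λ
_∣q→1+q = extend Λ-rawRing (λ f → con (q→1+q f)) p₁₊_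

------------------------------------------------------------------------
-- Elementary symmetric functions, by Newton's identities
--   (n + 1) eₙ₊₁ = Σ_{0 ≤ i ≤ n} (-1)ⁱ eₙ₋ᵢ pᵢ₊₁.

-- alternating i (Fᵢ ∷ Fᵢ₊₁ ∷ …) = Fᵢ pᵢ₊₁ − Fᵢ₊₁ pᵢ₊₂ + ⋯
alternating : ∀ {n} → ℕ → Vec Λ n → Λ
alternating i []       = 0Λ
alternating i (F ∷ Fs) = F ⊗ (p₁₊ i) ⊕ ⊖ alternating (suc i) Fs

-- e≤ n = eₙ ∷ eₙ₋₁ ∷ … ∷ e₀ ∷ []
e≤ : ∀ n → Vec Λ (suc n)
e≤ zero    = 1Λ ∷ []
e≤ (suc n) =
  con (ℚ[q].constant (+ 1 ℚ./ suc n)) ⊗ alternating 0 (e≤ n) ∷ e≤ n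

e : ℕ → Λ
e n = Vec.head (e≤ n)

e[_] : List ℕ → Λ
e[ μ ] = productΛ (map e μ)

------------------------------------------------------------------------
-- The operators B a.

-- Λ[z⁻¹]: the entry at position k is the coefficient of z⁻ᵏ.
module Λ[z⁻¹] = Polynomial Λ-rawRing

-- (-1)ᵏ (1 - qᵏ)
p[ε⟨1-q⟩] : ℕ → ℚ[q]
p[ε⟨1-q⟩] k = (K.- K.1#) ^ k K.* (K.1# K.+ (K.- (q ^ k)))
  where open RawSemiringDefs K.rawSemiring using (_^_)

-- F[X + ε(1-q)/z]
_[X+ε⟨1-q⟩/z] : Λ → Λ[z⁻¹].Poly
_[X+ε⟨1-q⟩/z] = extend Λ[z⁻¹].rawRing
  (λ f → Λ[z⁻¹].constant (con f))
  (λ k → Λ[z⁻¹].constant (p₁₊ k)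
           Λ[z⁻¹].+ₚ Λ[z⁻¹].monomial (con (p[ε⟨1-q⟩] (suc k))) (suc k))

-- The coefficient of zᵃ in (Σₖ Fₖ z⁻ᵏ) (Σᵣ Eᵣ zʳ), that is Σₖ Fₖ Eₐ₊ₖ.
zcoeff : Λ[z⁻¹].Poly → (ℕ → Λ) → ℕ → Λ
zcoeff []       E a = 0Λ
zcoeff (F ∷ Fs) E a = F ⊗ E a ⊕ zcoeff Fs E (suc a)

B : ℕ → Λ → Λ
B a F = zcoeff (F [X+ε⟨1-q⟩/z]) e a

B[_]1 : List ℕ → Λ
B[ p ]1 = foldr B 1Λ p

------------------------------------------------------------------------

-- Each composition of n + 2 arises from exactly one of n + 1, by
-- prepending a part 1 or by increasing the first part.
grow : List ℕ → List (List ℕ)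
grow []      = (1 ∷ []) ∷ []
grow (a ∷ c) = (1 ∷ a ∷ c) ∷ (suc a ∷ c) ∷ []

compositions : ℕ → List (List ℕ)
compositions zero    = [] ∷ []
compositions (suc n) = concatMap grow (compositions n)

-- The partitions of n, each listed once, as weakly decreasing lists.
partitions : ℕ → List (List ℕ)
partitions n = filter (linked? _≥?_) (compositions n)

module Submission where

-- Put Y = (1 - q)/z.  Since pₖ[εY] = (-1)ᵏ pₖ[Y], the generating function of
-- eₖ[εY] is Σ eₖ[εY] uᵏ = exp (- Σ pₖ[Y] uᵏ/k) = (1 - u/z) / (1 - qu/z), so
--   eₙ[X + εY] = eₙ + Σ_{k ≥ 1} (q - 1) qᵏ⁻¹ z⁻ᵏ eₙ₋ₖ.
-- Hence every B a preserves the cone generated by q, q - 1 and the eₙ under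
-- sums and products, and q → 1 + q turns q and q - 1 into 1 + q and q.

open import Defs
open import Algebra.Bundles using (CommutativeRing; RawRing)
import Algebra.Definitions.RawSemiring as RawSemiringDefs
open import Algebra.Morphism.Structures using (module RingMorphisms)
open import Data.Bool.Base using (if_then_else_)
open import Data.Empty using (⊥)
open import Data.Integer.Base as ℤ using (+_)
import Data.Integer.Properties as ℤₚ
open import Data.List.Base using (List; []; _∷_; _++_; concatMap; map; replicate; sum)
open import Data.List.Membership.Propositional using (_∈_; find)
open import Data.List.Membership.Propositional.Properties using (∈-concatMap⁺; ∈-concatMap⁻; ∈-filter⁺)
open import Data.List.Properties using (≡-dec)
open import Data.List.Relation.Binary.Permutation.Propositional as Perm using (_↭_; ↭-sym)
open import Data.List.Relation.Binary.Permutation.Propositional.Properties using (All-resp-↭)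
open import Data.List.Relation.Unary.All as All using (All; []; _∷_)
import Data.List.Relation.Unary.All.Properties as Allₚ
open import Data.List.Relation.Unary.AllPairs using ([]; _∷_)
open import Data.List.Relation.Unary.Any as Any using (here; there)
open import Data.List.Relation.Unary.Linked using (linked?)
open import Data.List.Relation.Unary.Unique.Propositional using (Unique)
import Data.List.Relation.Unary.Unique.Propositional.Properties as Unique
import Data.List.Sort as Sort
open import Data.Nat.Base as ℕ using (ℕ; zero; suc; _≤_; _≥_; z≤n; s≤s)
import Data.Nat.ListAction.Properties as ListAction
open import Data.Nat.Properties as ℕₚ using (_≥?_)
open import Data.Product.Base using (_,_; Σ-syntax; proj₂) renaming (_×_ to _∧_)
import Data.Rational.Base as ℚ
import Data.Rational.Properties as ℚₚ
import Data.Rational.Unnormalised.Base as ℚᵘ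
import Data.Rational.Unnormalised.Properties as ℚᵘₚ
open import Function.Base using (_∘_)
open import Level using (0ℓ)
import Relation.Binary.Construct.Flip.EqAndOrd as Flip
open import Relation.Binary.PropositionalEquality as ≡ using (_≡_; _≢_; cong; cong₂)
open import Relation.Nullary.Decidable using (does; dec-true; dec-false)

-- The exponential formula is not directly available: `Λ` is free on the power sums and `e` is
-- defined by Newton's recursion. The logarithmic derivative takes its place. The substitution
-- changes the signed power sums by a difference of two geometric sequences, and multiplying E(u) by
-- (1 - u/z) / (1 - qu/z) changes E'/E by the same amount. Both candidates for the image of `e` thus
-- satisfy one Newton recursion, which has a unique solution because every positive integer is
-- invertible. Membership in the cone is tracked together with the degree; without the degree, the
-- final expansion could involve partitions of numbers other than |p|.

private
  module 𝕂 = RawRing ℚ[q]-rawRing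
  module Λᴿ = CommutativeRing Λ-commutativeRing

open RingMorphisms using (IsRingHomomorphism)

-- The operation `ℚ._/_` reduces by a gcd and is stuck on variables, so the identity is checked on
-- unnormalised fractions.
fromℕ-+ : ∀ m n → + (m ℕ.+ n) ℚ./ 1 ≡ + m ℚ./ 1 ℚ.+ + n ℚ./ 1
fromℕ-+ m n = ℚₚ.toℚᵘ-injective (begin
  ℚ.toℚᵘ (ℚ.fromℚᵘ (ℚᵘ.mkℚᵘ (+ (m ℕ.+ n)) 0))
    ≈⟨ ℚₚ.toℚᵘ-fromℚᵘ _ ⟩
  ℚᵘ.mkℚᵘ (+ (m ℕ.+ n)) 0
    ≈⟨ ℚᵘ.*≡* (sum≡ (+ m) (+ n)) ⟩
  ℚᵘ.mkℚᵘ (+ m) 0 ℚᵘ.+ ℚᵘ.mkℚᵘ (+ n) 0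
    ≈⟨ ℚᵘₚ.+-cong (ℚₚ.toℚᵘ-fromℚᵘ (ℚᵘ.mkℚᵘ (+ m) 0)) (ℚₚ.toℚᵘ-fromℚᵘ (ℚᵘ.mkℚᵘ (+ n) 0)) ⟨
  ℚ.toℚᵘ (+ m ℚ./ 1) ℚᵘ.+ ℚ.toℚᵘ (+ n ℚ./ 1)
    ≈⟨ ℚₚ.toℚᵘ-homo-+ (+ m ℚ./ 1) (+ n ℚ./ 1) ⟨
  ℚ.toℚᵘ (+ m ℚ./ 1 ℚ.+ + n ℚ./ 1) ∎)
  where
  open import Relation.Binary.Reasoning.Setoid ℚᵘₚ.≃-setoid
  sum≡ : ∀ i j → (i ℤ.+ j) ℤ.* + 1 ≡ (i ℤ.* + 1 ℤ.+ j ℤ.* + 1) ℤ.* + 1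
  sum≡ i j rewrite ℤₚ.*-identityʳ i | ℤₚ.*-identityʳ j = ≡.refl

1/n*n : ∀ n → + 1 ℚ./ suc n ℚ.* (+ suc n ℚ./ 1) ≡ ℚ.1ℚ
1/n*n n = ℚₚ.toℚᵘ-injective (begin
  ℚ.toℚᵘ (+ 1 ℚ./ suc n ℚ.* (+ suc n ℚ./ 1))
    ≈⟨ ℚₚ.toℚᵘ-homo-* (+ 1 ℚ./ suc n) (+ suc n ℚ./ 1) ⟩
  ℚ.toℚᵘ (+ 1 ℚ./ suc n) ℚᵘ.* ℚ.toℚᵘ (+ suc n ℚ./ 1)
    ≈⟨ ℚᵘₚ.*-cong (ℚₚ.toℚᵘ-fromℚᵘ (ℚᵘ.mkℚᵘ (+ 1) n)) (ℚₚ.toℚᵘ-fromℚᵘ (ℚᵘ.mkℚᵘ (+ suc n) 0)) ⟩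
  ℚᵘ.mkℚᵘ (+ 1) n ℚᵘ.* ℚᵘ.mkℚᵘ (+ suc n) 0
    ≈⟨ ℚᵘ.*≡* (product≡ (+ suc n)) ⟩
  ℚ.toℚᵘ ℚ.1ℚ ∎)
  where
  open import Relation.Binary.Reasoning.Setoid ℚᵘₚ.≃-setoid
  product≡ : ∀ i → + 1 ℤ.* i ℤ.* + 1 ≡ + 1 ℤ.* (i ℤ.* + 1)
  product≡ i rewrite ℤₚ.*-identityˡ i | ℤₚ.*-identityʳ i = ≡.sym (ℤₚ.*-identityˡ i)

-- Newton recurrences over a commutative ring

module Convolution {c ℓ} (A : CommutativeRing c ℓ) where

  open CommutativeRing A renaming (_≈_ to _≈ᴬ_)
  open import Algebra.Properties.Semiring.Exp semiring using (_^_)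
  open import Algebra.Properties.Semiring.Mult semiring using (_×_)
  open import Algebra.Properties.Group +-group using () renaming (∙-cancelʳ to +-cancelʳ)
  open import Algebra.Solver.Ring.NaturalCoefficients.Default commutativeSemiring
    using (solve; con; _:=_; _:+_; _:*_)
  open import Relation.Binary.Reasoning.Setoid setoid

  -- The coefficient of uⁿ in G(u) P(u). Shifting `P` in the recursion avoids the subtraction n - i
  -- in the index of `G`.
  conv : (ℕ → Carrier) → (ℕ → Carrier) → ℕ → Carrier
  conv G P zero    = G 0 * P 0
  conv G P (suc n) = G (suc n) * P 0 + conv G (P ∘ suc) n

  -- Agreement of `G` and `G′` is asked only up to `n`, since the induction in `newton-unique` knows
  -- no more.
  conv-cong : ∀ n {G G′ P P′} → (∀ m → m ≤ n → G m ≈ᴬ G′ m) → (∀ i → P i ≈ᴬ P′ i) →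
              conv G P n ≈ᴬ conv G′ P′ n
  conv-cong zero    G≈ P≈ = *-cong (G≈ 0 z≤n) (P≈ 0)
  conv-cong (suc n) G≈ P≈ = +-cong (*-cong (G≈ (suc n) ℕₚ.≤-refl) (P≈ 0))
    (conv-cong n (λ m m≤n → G≈ m (ℕₚ.m≤n⇒m≤1+n m≤n)) (P≈ ∘ suc))

  conv-+ʳ : ∀ n {G P Q} → conv G (λ i → P i + Q i) n ≈ᴬ conv G P n + conv G Q n
  conv-+ʳ zero            = distribˡ _ _ _
  conv-+ʳ (suc n) {G} {P} {Q} = begin
    G (suc n) * (P 0 + Q 0) + conv G (λ i → P (suc i) + Q (suc i)) n
      ≈⟨ +-congˡ (conv-+ʳ n) ⟩
    G (suc n) * (P 0 + Q 0) + (conv G (P ∘ suc) n + conv G (Q ∘ suc) n)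
      ≈⟨ solve 5 (λ g p q r s → g :* (p :+ q) :+ (r :+ s) := (g :* p :+ r) :+ (g :* q :+ s)) refl _ _ _ _ _ ⟩
    conv G P (suc n) + conv G Q (suc n) ∎

  conv-*ʳ : ∀ n {G P} x → conv G (λ i → x * P i) n ≈ᴬ x * conv G P n
  conv-*ʳ zero    x = solve 3 (λ g x p → g :* (x :* p) := x :* (g :* p)) refl _ _ _
  conv-*ʳ (suc n) {G} {P} x = begin
    G (suc n) * (x * P 0) + conv G (λ i → x * P (suc i)) n
      ≈⟨ +-congˡ (conv-*ʳ n x) ⟩
    G (suc n) * (x * P 0) + x * conv G (P ∘ suc) n
      ≈⟨ solve 4 (λ g x p r → g :* (x :* p) :+ x :* r := x :* (g :* p :+ r)) refl _ _ _ _ ⟩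
    x * conv G P (suc n) ∎

  -- The series S(u) = G(u) x / (1 - xu) satisfies S = xG + xuS; this is the coefficient of uⁿ⁺¹.
  geometric : ∀ n {G} x → conv G (λ i → x ^ suc i) (suc n) ≈ᴬ
                          x * G (suc n) + x * conv G (λ i → x ^ suc i) n
  geometric n x =
    +-cong (solve 2 (λ g x → g :* (x :* con 1) := x :* g) refl _ _) (conv-*ʳ n x)

  -- The hypotheses say (1 - yu) H(u) = (1 - xu) E(u), and the conclusion is this relation
  -- multiplied by P(u). Both are written without subtraction, within reach of the semiring solver.
  conv-linearˡ : ∀ {E H x y} → H 0 ≈ᴬ E 0 → (∀ n → H (suc n) + x * E n ≈ᴬ E (suc n) + y * H n) →
                 ∀ n {P} → conv H P (suc n) + x * conv E P n ≈ᴬ conv E P (suc n) + y * conv H P n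
  conv-linearˡ {E} {H} {x} {y} base step zero {P} = begin
    (H 1 * P 0 + H 0 * P 1) + x * (E 0 * P 0)
      ≈⟨ solve 5 (λ h p r x e → (h :* p :+ r) :+ x :* (e :* p) := (h :+ x :* e) :* p :+ r) refl _ _ _ _ _ ⟩
    (H 1 + x * E 0) * P 0 + H 0 * P 1
      ≈⟨ +-cong (*-congʳ (step 0)) (*-congʳ base) ⟩
    (E 1 + y * H 0) * P 0 + E 0 * P 1
      ≈⟨ solve 5 (λ h p r x e → (h :+ x :* e) :* p :+ r := (h :* p :+ r) :+ x :* (e :* p)) refl _ _ _ _ _ ⟩
    (E 1 * P 0 + E 0 * P 1) + y * (H 0 * P 0) ∎
  conv-linearˡ {E} {H} {x} {y} base step (suc n) {P} = begin
    (H (2 ℕ.+ n) * P 0 + conv H P⁺ (suc n)) + x * (E (suc n) * P 0 + conv E P⁺ n)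
      ≈⟨ solve 6 (λ h p r x e s → (h :* p :+ r) :+ x :* (e :* p :+ s) := (h :+ x :* e) :* p :+ (r :+ x :* s)) refl _ _ _ _ _ _ ⟩
    (H (2 ℕ.+ n) + x * E (suc n)) * P 0 + (conv H P⁺ (suc n) + x * conv E P⁺ n)
      ≈⟨ +-cong (*-congʳ (step (suc n))) (conv-linearˡ base step n) ⟩
    (E (2 ℕ.+ n) + y * H (suc n)) * P 0 + (conv E P⁺ (suc n) + y * conv H P⁺ n)
      ≈⟨ solve 6 (λ h p r x e s → (h :+ x :* e) :* p :+ (r :+ x :* s) := (h :* p :+ r) :+ x :* (e :* p :+ s)) refl _ _ _ _ _ _ ⟩
    (E (2 ℕ.+ n) * P 0 + conv E P⁺ (suc n)) + y * (H (suc n) * P 0 + conv H P⁺ n) ∎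
    where P⁺ = P ∘ suc

  -- With E(u) = Σ Eₙ uⁿ and y = x + d, K(u) = E(u) / (1 - yu) and
  -- H(u) = E(u) (1 - xu) / (1 - yu).
  module _ (E : ℕ → Carrier) (x d : Carrier) where

    K : ℕ → Carrier
    K zero    = E 0
    K (suc n) = E (suc n) + (x + d) * K n

    H : ℕ → Carrier
    H zero    = E 0
    H (suc n) = E (suc n) + d * K n

    H-recurrence : ∀ n → H (suc n) + x * E n ≈ᴬ E (suc n) + (x + d) * H n
    H-recurrence zero    =
      solve 4 (λ a d b x → (a :+ d :* b) :+ x :* b := a :+ (x :+ d) :* b) refl _ _ _ _
    H-recurrence (suc n) =
      solve 5 (λ a d b x k → (a :+ d :* (b :+ (x :+ d) :* k)) :+ x :* b
                          := a :+ (x :+ d) :* (b :+ d :* k)) refl _ _ _ _ _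

    -- The factor 1 - xu of H(u) cancels the denominator of x / (1 - xu), which leaves x E(u) / (1 -
    -- yu).
    geometric-H : ∀ n → conv H (λ i → x ^ suc i) n ≈ᴬ x * K n
    geometric-H zero    = solve 2 (λ e x → e :* (x :* con 1) := x :* e) refl _ _
    geometric-H (suc n) = begin
      conv H (λ i → x ^ suc i) (suc n)
        ≈⟨ geometric n x ⟩
      x * H (suc n) + x * conv H (λ i → x ^ suc i) n
        ≈⟨ +-congˡ (*-congˡ (geometric-H n)) ⟩
      x * (E (suc n) + d * K n) + x * (x * K n)
        ≈⟨ solve 4 (λ x e d k → x :* (e :+ d :* k) :+ x :* (x :* k) := x :* (e :+ (x :+ d) :* k)) refl _ _ _ _ ⟩
      x * K (suc n) ∎

    module _ {P : ℕ → Carrier} (E-newton : ∀ n → (suc n × 1#) * E (suc n) ≈ᴬ conv E P n) where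

      private
        g : ℕ → Carrier
        g = conv H (λ i → (x + d) ^ suc i)

      -- The term x * K n is conv H of the powers of x; it stands on the left so
      -- that both sides are semiring expressions.
      H-newton′ : ∀ n → (suc n × 1#) * H (suc n) + x * K n ≈ᴬ conv H P n + g n
      H-newton′ zero = begin
        (1# + 0#) * (E 1 + d * E 0) + x * E 0
          ≈⟨ solve 4 (λ a d b x → (con 1 :+ con 0) :* (a :+ d :* b) :+ x :* b
                              := (con 1 :+ con 0) :* a :+ b :* ((x :+ d) :* con 1)) refl _ _ _ _ ⟩
        (1# + 0#) * E 1 + E 0 * ((x + d) * 1#)
          ≈⟨ +-congʳ (E-newton 0) ⟩
        E 0 * P 0 + E 0 * ((x + d) * 1#) ∎
      -- The added term equals `x * (ν⁺ * E (suc n))`. Together with the `x * E (suc n)` inside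
      -- `x * K (suc n)` it gives `ν⁺⁺` copies, just what `H-recurrence` needs; on the right it
      -- completes `conv-linearˡ`.
      H-newton′ (suc n) = +-cancelʳ (x * conv E P n) _ _ (begin
        (ν⁺⁺ * H (2 ℕ.+ n) + x * K (suc n)) + x * conv E P n
          ≈⟨ +-congˡ (*-congˡ (E-newton n)) ⟨
        (ν⁺⁺ * H (2 ℕ.+ n) + x * (E (suc n) + (x + d) * K n)) + x * (ν⁺ * E (suc n))
          ≈⟨ solve 6 (λ ν h x e d k →
               ((con 1 :+ ν) :* h :+ x :* (e :+ (x :+ d) :* k)) :+ x :* (ν :* e)
               := (con 1 :+ ν) :* (h :+ x :* e) :+ (x :+ d) :* (x :* k)) refl _ _ _ _ _ _ ⟩
        ν⁺⁺ * (H (2 ℕ.+ n) + x * E (suc n)) + (x + d) * (x * K n)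
          ≈⟨ +-congʳ (*-congˡ (H-recurrence (suc n))) ⟩
        ν⁺⁺ * (E (2 ℕ.+ n) + (x + d) * H (suc n)) + (x + d) * (x * K n)
          ≈⟨ solve 5 (λ ν e y h k →
               (con 1 :+ ν) :* (e :+ y :* h) :+ y :* k
               := (con 1 :+ ν) :* e :+ y :* h :+ y :* (ν :* h :+ k)) refl _ _ _ _ _ ⟩
        ν⁺⁺ * E (2 ℕ.+ n) + (x + d) * H (suc n) + (x + d) * (ν⁺ * H (suc n) + x * K n)
          ≈⟨ +-cong (+-congʳ (E-newton (suc n))) (*-congˡ (H-newton′ n)) ⟩
        conv E P (suc n) + (x + d) * H (suc n) + (x + d) * (conv H P n + g n)
          ≈⟨ solve 5 (λ a y h b c → a :+ y :* h :+ y :* (b :+ c) := (a :+ y :* b) :+ (y :* h :+ y :* c)) refl _ _ _ _ _ ⟩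
        (conv E P (suc n) + (x + d) * conv H P n) + ((x + d) * H (suc n) + (x + d) * g n)
          ≈⟨ +-cong (conv-linearˡ refl H-recurrence n) (geometric n (x + d)) ⟨
        (conv H P (suc n) + x * conv E P n) + g (suc n)
          ≈⟨ solve 3 (λ a b c → (a :+ b) :+ c := (a :+ c) :+ b) refl _ _ _ ⟩
        (conv H P (suc n) + g (suc n)) + x * conv E P n ∎)
        where
        ν⁺ = suc n × 1#
        ν⁺⁺ = suc (suc n) × 1#

      -- This is H′/H = E′/E + y/(1 - yu) - x/(1 - xu), compared coefficientwise.
      H-newton : ∀ {Q} → (∀ i → Q i + x ^ suc i ≈ᴬ P i + (x + d) ^ suc i) →
                 ∀ n → (suc n × 1#) * H (suc n) ≈ᴬ conv H Q n
      H-newton {Q} Q≈ n = +-cancelʳ (x * K n) _ _ (begin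
        (suc n × 1#) * H (suc n) + x * K n                    ≈⟨ H-newton′ n ⟩
        conv H P n + g n                                      ≈⟨ conv-+ʳ n ⟨
        conv H (λ i → P i + (x + d) ^ suc i) n                ≈⟨ conv-cong n (λ _ _ → refl) Q≈ ⟨
        conv H (λ i → Q i + x ^ suc i) n                      ≈⟨ conv-+ʳ n ⟩
        conv H Q n + conv H (λ i → x ^ suc i) n               ≈⟨ +-congˡ (geometric-H n) ⟩
        conv H Q n + x * K n                                  ∎)

  -- Dividing by `suc n` makes each term a function of all earlier ones, so `below` proves agreement
  -- for every index up to a bound.
  newton-unique : ∀ {P G G′} (inv : ℕ → Carrier) → (∀ n → inv n * (suc n × 1#) ≈ᴬ 1#) →
                  G 0 ≈ᴬ G′ 0 →
                  (∀ n → (suc n × 1#) * G (suc n) ≈ᴬ conv G P n) →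
                  (∀ n → (suc n × 1#) * G′ (suc n) ≈ᴬ conv G′ P n) →
                  ∀ n → G n ≈ᴬ G′ n
  newton-unique {P} {G} {G′} inv inv-inverse base G-newton G′-newton n = below n n ℕₚ.≤-refl
    where
    divide : ∀ m x → inv m * ((suc m × 1#) * x) ≈ᴬ x
    divide m x = trans (sym (*-assoc _ _ _)) (trans (*-congʳ (inv-inverse m)) (*-identityˡ x))

    below : ∀ n m → m ≤ n → G m ≈ᴬ G′ m
    below n       zero    _         = base
    below (suc n) (suc m) (s≤s m≤n) = begin
      G (suc m)                             ≈⟨ divide m _ ⟨
      inv m * ((suc m × 1#) * G (suc m))    ≈⟨ *-congˡ (G-newton m) ⟩
      inv m * conv G P m                    ≈⟨ *-congˡ (conv-cong m (λ k k≤m → below n k (ℕₚ.≤-trans k≤m m≤n)) (λ _ → refl)) ⟩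
      inv m * conv G′ P m                   ≈⟨ *-congˡ (G′-newton m) ⟨
      inv m * ((suc m × 1#) * G′ (suc m))   ≈⟨ divide m _ ⟩
      G′ (suc m)                            ∎

-- The signed power sums of X + ε(1 - q)/z

module Signs {c ℓ} (A : CommutativeRing c ℓ) where
  open CommutativeRing A renaming (_≈_ to _≈ᴬ_)
  open import Algebra.Properties.Semiring.Exp semiring using (_^_)
  open import Algebra.Properties.CommutativeSemiring.Exp commutativeSemiring using (^-distrib-*)
  open import Algebra.Properties.Ring ring using (-1*x≈-x; -‿involutive)
  open import Algebra.Solver.Ring.NaturalCoefficients.Default commutativeSemiring
    using (solve; _:=_; _:+_; _:*_) renaming (con to ‵_)
  open import Relation.Binary.Reasoning.Setoid setoid

  sign² : ∀ n → (- 1#) ^ n * (- 1#) ^ n ≈ᴬ 1#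
  sign² zero    = *-identityˡ 1#
  sign² (suc n) = begin
    (- 1# * s) * (- 1# * s)     ≈⟨ solve 2 (λ t s → (t :* s) :* (t :* s) := (t :* t) :* (s :* s)) refl _ _ ⟩
    (- 1# * - 1#) * (s * s)     ≈⟨ *-cong (trans (-1*x≈-x _) (-‿involutive 1#)) (sign² n) ⟩
    1# * 1#                     ≈⟨ *-identityˡ 1# ⟩
    1#                          ∎
    where s = (- 1#) ^ n

  -- The sign (-1)ⁱ of Newton's identity and the sign (-1)ⁱ⁺¹ of ε multiply to -1, so the signed
  -- power sum gains (yw)ᵏ - wᵏ. Moving wᵏ to the left gives the shape required by `H-newton`.
  signed-shift : ∀ i p y w → let k = suc i in
    (- 1#) ^ i * (p + ((- 1#) ^ k * (1# + - (y ^ k))) * w ^ k) + w ^ k ≈ᴬ (- 1#) ^ i * p + (y * w) ^ k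
  signed-shift i p y w = begin
    s * (p + ((- 1# * s) * (1# + m)) * v) + v
      ≈⟨ solve 5 (λ s p t m v → s :* (p :+ ((t :* s) :* (‵ 1 :+ m)) :* v) :+ v
                             := s :* p :+ ((s :* s) :* (t :+ t :* m) :* v :+ v)) refl s p (- 1#) m v ⟩
    s * p + ((s * s) * (- 1# + - 1# * m) * v + v)
      ≈⟨ +-congˡ (+-congʳ (*-congʳ (*-cong (sign² i) (+-congˡ (trans (-1*x≈-x m) (-‿involutive _)))))) ⟩
    s * p + (1# * (- 1# + y ^ suc i) * v + v)
      ≈⟨ solve 5 (λ s p t y v → s :* p :+ (‵ 1 :* (t :+ y) :* v :+ v) := s :* p :+ ((t :+ ‵ 1) :* v :+ y :* v)) refl s p (- 1#) (y ^ suc i) v ⟩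
    s * p + ((- 1# + 1#) * v + y ^ suc i * v)
      ≈⟨ +-congˡ (+-cong (trans (*-congʳ (-‿inverseˡ 1#)) (zeroˡ v)) (sym (^-distrib-* y w (suc i)))) ⟩
    s * p + (0# + (y * w) ^ suc i)
      ≈⟨ +-congˡ (+-identityˡ _) ⟩
    s * p + (y * w) ^ suc i ∎
    where
    s = (- 1#) ^ i
    v = w ^ suc i
    m = - (y ^ suc i)

-- Homomorphisms out of the free algebra

module _ {c ℓ} (A : CommutativeRing c ℓ)
         {C : ℚ[q] → CommutativeRing.Carrier A} {P : ℕ → CommutativeRing.Carrier A} where

  open CommutativeRing A renaming (_≈_ to _≈ᴬ_)

  -- Operations are preserved by the clauses of `extend`, so the content is that the generated
  -- congruence is respected. By freeness, this constrains the images of coefficients but not those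
  -- of power sums.
  extend-isRingHomomorphism :
    (∀ {f g} → f 𝕂.≈ g → C f ≈ᴬ C g) →
    (∀ f g → C (f 𝕂.+ g) ≈ᴬ C f + C g) →
    (∀ f g → C (f 𝕂.* g) ≈ᴬ C f * C g) →
    C 𝕂.0# ≈ᴬ 0# →
    C 𝕂.1# ≈ᴬ 1# →
    IsRingHomomorphism Λ-rawRing rawRing (extend rawRing C P)
  extend-isRingHomomorphism C-cong C-+ C-* C-0 C-1 = record
    { isSemiringHomomorphism = record
      { isNearSemiringHomomorphism = record
        { +-isMonoidHomomorphism = record
          { isMagmaHomomorphism = record
            { isRelHomomorphism = record { cong = ⟦⟧-cong }
            ; homo = λ _ _ → refl
            }
          ; ε-homo = C-0
          }
        ; *-homo = λ _ _ → refl
        }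
      ; 1#-homo = C-1
      }
    ; -‿homo = λ _ → refl
    }
    where
    ⟦_⟧ = extend rawRing C P

    ⟦⟧-cong : ∀ {F G} → F ≈ G → ⟦ F ⟧ ≈ᴬ ⟦ G ⟧
    ⟦⟧-cong ≈-refl              = refl
    ⟦⟧-cong (≈-sym p)           = sym (⟦⟧-cong p)
    ⟦⟧-cong (≈-trans p q)       = trans (⟦⟧-cong p) (⟦⟧-cong q)
    ⟦⟧-cong (con-cong p)        = C-cong p
    ⟦⟧-cong (⊕-cong p q)        = +-cong (⟦⟧-cong p) (⟦⟧-cong q)
    ⟦⟧-cong (⊗-cong p q)        = *-cong (⟦⟧-cong p) (⟦⟧-cong q)
    ⟦⟧-cong (⊖-cong p)          = -‿cong (⟦⟧-cong p)
    ⟦⟧-cong (con-+ f g)         = C-+ f g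
    ⟦⟧-cong (con-* f g)         = C-* f g
    ⟦⟧-cong (⊕-assoc F G H)     = +-assoc _ _ _
    ⟦⟧-cong (⊕-comm F G)        = +-comm _ _
    ⟦⟧-cong (⊕-identityˡ F)     = trans (+-congʳ C-0) (+-identityˡ _)
    ⟦⟧-cong (⊖-inverseˡ F)      = trans (-‿inverseˡ _) (sym C-0)
    ⟦⟧-cong (⊗-assoc F G H)     = *-assoc _ _ _
    ⟦⟧-cong (⊗-comm F G)        = *-comm _ _
    ⟦⟧-cong (⊗-identityˡ F)     = trans (*-congʳ C-1) (*-identityˡ _)
    ⟦⟧-cong (⊗-distribʳ F G H)  = distribʳ _ _ _

-- Coefficients as elements of Λ

𝐪 : Λ
𝐪 = con q

con-constant-* : ∀ a b → con (ℚ[q].constant (a ℚ.* b)) ≈ con (ℚ[q].constant a) ⊗ con (ℚ[q].constant b)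
con-constant-* a b = ≈-trans (con-cong (ℚ[q].coeffwise λ
  { zero    → ≡.sym (ℚₚ.+-identityʳ (a ℚ.* b))
  ; (suc n) → ≡.refl }))
  (con-* (ℚ[q].constant a) (ℚ[q].constant b))

con-constant-0 : con (ℚ[q].constant ℚ.0ℚ) ≈ 0Λ
con-constant-0 = con-cong (ℚ[q].coeffwise λ { zero → ≡.refl ; (suc n) → ≡.refl })

-- No generator of the congruence mentions negated coefficients; uniqueness of additive inverses
-- supplies the rule.
con-neg : ∀ f → con (𝕂.- f) ≈ ⊖ con f
con-neg f = -‿inverseˡ-unique _ _
  (≈-trans (≈-sym (con-+ (𝕂.- f) f)) (con-cong (ℚ[q].coeffwise (coeff-inverseˡ f))))
  where
  open import Algebra.Properties.Group Λᴿ.+-group renaming (inverseˡ-unique to -‿inverseˡ-unique)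
  coeff-inverseˡ : ∀ f n → ℚ[q].coeff (𝕂.- f 𝕂.+ f) n ≡ ℚ.0ℚ
  coeff-inverseˡ []      n       = ≡.refl
  coeff-inverseˡ (a ∷ f) zero    = ℚₚ.+-inverseˡ a
  coeff-inverseˡ (a ∷ f) (suc n) = coeff-inverseˡ f n

module _ where
  open import Algebra.Properties.Semiring.Exp Λᴿ.semiring using (_^_; ^-congˡ)
  open import Algebra.Properties.Semiring.Mult Λᴿ.semiring using (_×_)
  open RawSemiringDefs 𝕂.rawSemiring using () renaming (_^_ to _^ᴷ_)

  con-^ : ∀ f n → con (f ^ᴷ n) ≈ con f ^ n
  con-^ f zero    = ≈-refl
  con-^ f (suc n) = ≈-trans (con-* f (f ^ᴷ n)) (⊗-cong ≈-refl (con-^ f n))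

  con-p[ε⟨1-q⟩] : ∀ n → con (p[ε⟨1-q⟩] n) ≈ (⊖ 1Λ) ^ n ⊗ (1Λ ⊕ ⊖ (𝐪 ^ n))
  con-p[ε⟨1-q⟩] n = begin
    con ((𝕂.- 𝕂.1#) ^ᴷ n 𝕂.* (𝕂.1# 𝕂.+ (𝕂.- (q ^ᴷ n))))      ≈⟨ con-* _ _ ⟩
    con ((𝕂.- 𝕂.1#) ^ᴷ n) ⊗ con (𝕂.1# 𝕂.+ (𝕂.- (q ^ᴷ n)))    ≈⟨ ⊗-cong (con-^ _ n) (con-+ _ _) ⟩
    con (𝕂.- 𝕂.1#) ^ n ⊗ (1Λ ⊕ con (𝕂.- (q ^ᴷ n)))           ≈⟨ ⊗-cong (^-congˡ n (con-neg _)) (⊕-cong ≈-refl (con-neg _)) ⟩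
    (⊖ 1Λ) ^ n ⊗ (1Λ ⊕ ⊖ con (q ^ᴷ n))                       ≈⟨ ⊗-cong ≈-refl (⊕-cong ≈-refl (⊖-cong (con-^ q n))) ⟩
    (⊖ 1Λ) ^ n ⊗ (1Λ ⊕ ⊖ (𝐪 ^ n))                            ∎
    where
    open import Relation.Binary.Reasoning.Setoid Λᴿ.setoid

  con-fromℕ : ∀ n → con (ℚ[q].constant (+ n ℚ./ 1)) ≈ n × 1Λ
  con-fromℕ zero    = con-constant-0
  con-fromℕ (suc n) = ≈-trans
    (con-cong (ℚ[q].coeffwise λ { zero → fromℕ-+ 1 n ; (suc n) → ≡.refl }))
    (≈-trans (con-+ _ _) (⊕-cong ≈-refl (con-fromℕ n)))

  con-1/n : ∀ n → con (ℚ[q].constant (+ 1 ℚ./ suc n)) ⊗ (suc n × 1Λ) ≈ 1Λ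
  con-1/n n = ≈-trans (⊗-cong ≈-refl (≈-sym (con-fromℕ (suc n))))
    (≈-trans (≈-sym (con-constant-* _ _))
      (con-cong (ℚ[q].coeffwise λ { zero → 1/n*n n ; (suc n) → ≡.refl })))

-- Newton's identities under a homomorphism

module _ {c ℓ} (A : CommutativeRing c ℓ) {h : Λ → CommutativeRing.Carrier A}
         (isHom : IsRingHomomorphism Λ-rawRing (CommutativeRing.rawRing A) h) where

  open CommutativeRing A renaming (_≈_ to _≈ᴬ_; refl to ≈ᴬ-refl)
  open IsRingHomomorphism isHom
  open Convolution A
  open import Algebra.Properties.Semiring.Exp semiring using (_^_)
  open import Algebra.Properties.Semiring.Mult semiring using (_×_)
  import Algebra.Properties.Semiring.Exp Λᴿ.semiring as Λ-Exp
  import Algebra.Properties.Semiring.Mult Λᴿ.semiring as Λ-Mult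
  open import Algebra.Properties.Ring ring using (-1*x≈-x; -‿distribʳ-*)
  open import Algebra.Solver.Ring.NaturalCoefficients.Default commutativeSemiring
    using (solve; _:=_; _:+_; _:*_)
  open import Relation.Binary.Reasoning.Setoid setoid

  -- Images of the coefficients of E'(u)/E(u), where E(u) is the generating function of `e`.
  signedₕ : ℕ → Carrier
  signedₕ i = (- 1#) ^ i * h (p₁₊ i)

  homo-^ : ∀ F n → h (F Λ-Exp.^ n) ≈ᴬ h F ^ n
  homo-^ F zero    = 1#-homo
  homo-^ F (suc n) = trans (*-homo F _) (*-congˡ (homo-^ F n))

  homo-×1 : ∀ n → h (n Λ-Mult.× 1Λ) ≈ᴬ n × 1#
  homo-×1 zero    = 0#-homo
  homo-×1 (suc n) = trans (+-homo _ _) (+-cong 1#-homo (homo-×1 n))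

  homo-1/n : ∀ n → h (con (ℚ[q].constant (+ 1 ℚ./ suc n))) * (suc n × 1#) ≈ᴬ 1#
  homo-1/n n = begin
    h r * (suc n × 1#)              ≈⟨ *-congˡ (homo-×1 (suc n)) ⟨
    h r * h (suc n Λ-Mult.× 1Λ)     ≈⟨ *-homo _ _ ⟨
    h (r ⊗ (suc n Λ-Mult.× 1Λ))     ≈⟨ ⟦⟧-cong (con-1/n n) ⟩
    h 1Λ                            ≈⟨ 1#-homo ⟩
    1#                              ∎
    where r = con (ℚ[q].constant (+ 1 ℚ./ suc n))

  -- Each level of `alternating` negates the rest of the sum. The prefactor (-1)ⁱ absorbs these
  -- signs, so that the induction can pass from `i` to `suc i`.
  homo-alternating : ∀ n i →
    (- 1#) ^ i * h (alternating i (e≤ n)) ≈ᴬ conv (h ∘ e) (λ j → signedₕ (j ℕ.+ i)) n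
  homo-alternating zero i = begin
    (- 1#) ^ i * h (1Λ ⊗ p₁₊ i ⊕ ⊖ 0Λ)       ≈⟨ *-congˡ (⟦⟧-cong (≈-trans (Λᴿ.+-congˡ Λ-0) (Λᴿ.+-identityʳ _))) ⟩
    (- 1#) ^ i * h (1Λ ⊗ p₁₊ i)              ≈⟨ *-congˡ (*-homo _ _) ⟩
    (- 1#) ^ i * (h 1Λ * h (p₁₊ i))          ≈⟨ solve 3 (λ s a p → s :* (a :* p) := a :* (s :* p)) ≈ᴬ-refl _ _ _ ⟩
    h 1Λ * ((- 1#) ^ i * h (p₁₊ i))          ∎
    where
    open import Algebra.Properties.Ring Λᴿ.ring using () renaming (-0#≈0# to Λ-0)
  homo-alternating (suc n) i = begin
    s * h (e (suc n) ⊗ p₁₊ i ⊕ ⊖ a)                   ≈⟨ *-congˡ (trans (+-homo _ _) (+-cong (*-homo _ _) (-‿homo a))) ⟩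
    s * (h (e (suc n)) * h (p₁₊ i) + - h a)           ≈⟨ distribˡ _ _ _ ⟩
    s * (h (e (suc n)) * h (p₁₊ i)) + s * - h a       ≈⟨ +-cong (solve 3 (λ s a p → s :* (a :* p) := a :* (s :* p)) ≈ᴬ-refl _ _ _) sign ⟩
    h (e (suc n)) * signedₕ i + (- 1#) ^ suc i * h a  ≈⟨ +-congˡ (homo-alternating n (suc i)) ⟩
    h (e (suc n)) * signedₕ i + conv (h ∘ e) (λ j → signedₕ (j ℕ.+ suc i)) n
      ≈⟨ +-congˡ (conv-cong n (λ _ _ → ≈ᴬ-refl) (λ j → reflexive (cong signedₕ (ℕₚ.+-suc j i)))) ⟩
    conv (h ∘ e) (λ j → signedₕ (j ℕ.+ i)) (suc n)    ∎
    where
    s = (- 1#) ^ i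
    a = alternating (suc i) (e≤ n)
    sign : s * - h a ≈ᴬ (- 1# * s) * h a
    sign = begin
      s * - h a          ≈⟨ -‿distribʳ-* _ _ ⟨
      - (s * h a)        ≈⟨ -1*x≈-x _ ⟨
      - 1# * (s * h a)   ≈⟨ *-assoc _ _ _ ⟨
      (- 1# * s) * h a   ∎

  -- Stated for any homomorphism because it is applied twice: to the inclusion of constants and to
  -- the substitution itself.
  newton : ∀ n → (suc n × 1#) * h (e (suc n)) ≈ᴬ conv (h ∘ e) signedₕ n
  newton n = begin
    ν * h (r ⊗ a)            ≈⟨ *-congˡ (*-homo _ _) ⟩
    ν * (h r * h a)          ≈⟨ solve 3 (λ n r a → n :* (r :* a) := (r :* n) :* a) ≈ᴬ-refl _ _ _ ⟩
    (h r * ν) * h a          ≈⟨ *-congʳ (homo-1/n n) ⟩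
    -- The factor `1#` is the sign `(- 1#) ^ 0` carried by `homo-alternating`.
    1# * h a                 ≈⟨ homo-alternating n 0 ⟩
    conv (h ∘ e) (λ j → signedₕ (j ℕ.+ 0)) n
      ≈⟨ conv-cong n (λ _ _ → ≈ᴬ-refl) (λ j → reflexive (cong signedₕ (ℕₚ.+-identityʳ j))) ⟩
    conv (h ∘ e) signedₕ n   ∎
    where
    ν = suc n × 1#
    r = con (ℚ[q].constant (+ 1 ℚ./ suc n))
    a = alternating 0 (e≤ n)

module _ where
  open Λ[z⁻¹] using (_+ₚ_; _*ₚ_; constant; monomial)
  open Λᴿ hiding (_≈_; _-_)
  open import Algebra.Properties.Ring Λᴿ.ring using (-‿distribˡ-*; -‿+-comm; -0#≈0#)
  open import Algebra.Solver.Ring.NaturalCoefficients.Default Λᴿ.commutativeSemiring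
    using (solve; _:=_; _:+_; _:*_)
  open import Relation.Binary.Reasoning.Setoid Λᴿ.setoid

  -- The action of Λ[z⁻¹] on coefficient sequences

  zcoeff-cong : ∀ Φ {D E} → (∀ a → D a ≈ E a) → ∀ a → zcoeff Φ D a ≈ zcoeff Φ E a
  zcoeff-cong []      D≈E a = refl
  zcoeff-cong (F ∷ Φ) D≈E a = +-cong (*-congˡ (D≈E a)) (zcoeff-cong Φ D≈E (suc a))

  zcoeff-suc : ∀ Φ {E} a → zcoeff Φ (E ∘ suc) a ≈ zcoeff Φ E (suc a)
  zcoeff-suc []      a = refl
  zcoeff-suc (F ∷ Φ) a = +-congˡ (zcoeff-suc Φ (suc a))

  zcoeff-*ʳ : ∀ Φ {E} F a → zcoeff Φ (λ b → F * E b) a ≈ F * zcoeff Φ E a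
  zcoeff-*ʳ []      F a = sym (zeroʳ F)
  zcoeff-*ʳ (G ∷ Φ) F a = begin
    G * (F * _) + zcoeff Φ _ (suc a)   ≈⟨ +-congˡ (zcoeff-*ʳ Φ F (suc a)) ⟩
    G * (F * _) + F * _                ≈⟨ solve 4 (λ g f e r → g :* (f :* e) :+ f :* r := f :* (g :* e :+ r)) refl _ _ _ _ ⟩
    F * (G * _ + _)                    ∎

  zcoeff-+ʳ : ∀ Φ {D E} a → zcoeff Φ (λ b → D b + E b) a ≈ zcoeff Φ D a + zcoeff Φ E a
  zcoeff-+ʳ []      a = sym (+-identityʳ 0Λ)
  zcoeff-+ʳ (G ∷ Φ) a = begin
    G * (_ + _) + zcoeff Φ _ (suc a)   ≈⟨ +-congˡ (zcoeff-+ʳ Φ (suc a)) ⟩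
    G * (_ + _) + (_ + _)              ≈⟨ solve 5 (λ g d e r s → g :* (d :+ e) :+ (r :+ s) := (g :* d :+ r) :+ (g :* e :+ s)) refl _ _ _ _ _ ⟩
    (G * _ + _) + (G * _ + _)          ∎

  zcoeff-0ʳ : ∀ Φ a → zcoeff Φ (λ _ → 0Λ) a ≈ 0Λ
  zcoeff-0ʳ []      a = refl
  zcoeff-0ʳ (G ∷ Φ) a = trans (+-cong (zeroʳ G) (zcoeff-0ʳ Φ (suc a))) (+-identityˡ 0Λ)

  zcoeff-+ : ∀ Φ Ψ {E} a → zcoeff (Φ +ₚ Ψ) E a ≈ zcoeff Φ E a + zcoeff Ψ E a
  zcoeff-+ []      Ψ       a = sym (+-identityˡ _)
  zcoeff-+ (F ∷ Φ) []      a = sym (+-identityʳ _)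
  zcoeff-+ (F ∷ Φ) (G ∷ Ψ) a = begin
    (F + G) * _ + zcoeff (Φ +ₚ Ψ) _ (suc a)   ≈⟨ +-congˡ (zcoeff-+ Φ Ψ (suc a)) ⟩
    (F + G) * _ + (_ + _)                     ≈⟨ solve 5 (λ f g e r s → (f :+ g) :* e :+ (r :+ s) := (f :* e :+ r) :+ (g :* e :+ s)) refl _ _ _ _ _ ⟩
    (F * _ + _) + (G * _ + _)                 ∎

  zcoeff-map-* : ∀ F Φ {E} a → zcoeff (map (F *_) Φ) E a ≈ F * zcoeff Φ E a
  zcoeff-map-* F []      a = sym (zeroʳ F)
  zcoeff-map-* F (G ∷ Φ) a = begin
    F * G * _ + zcoeff (map (F *_) Φ) _ (suc a)   ≈⟨ +-congˡ (zcoeff-map-* F Φ (suc a)) ⟩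
    F * G * _ + F * _                             ≈⟨ solve 4 (λ f g e r → f :* g :* e :+ f :* r := f :* (g :* e :+ r)) refl _ _ _ _ ⟩
    F * (G * _ + _)                               ∎

  zcoeff-neg : ∀ Φ {E} a → zcoeff (map -_ Φ) E a ≈ - zcoeff Φ E a
  zcoeff-neg []      a = sym -0#≈0#
  zcoeff-neg (F ∷ Φ) a =
    trans (+-cong (sym (-‿distribˡ-* F _)) (zcoeff-neg Φ (suc a))) (-‿+-comm _ _)

  zcoeff-0∷ : ∀ Φ {E} a → zcoeff (0Λ ∷ Φ) E a ≈ zcoeff Φ E (suc a)
  zcoeff-0∷ Φ a = trans (+-congʳ (zeroˡ _)) (+-identityˡ _)

  zcoeff-constant : ∀ F E a → zcoeff (constant F) E a ≈ F * E a
  zcoeff-constant F E a = +-identityʳ _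

  zcoeff-1 : ∀ E a → zcoeff (constant 1Λ) E a ≈ E a
  zcoeff-1 E a = trans (zcoeff-constant 1Λ E a) (*-identityˡ _)

  zcoeff-monomial : ∀ F n {E} a → zcoeff (monomial F n) E a ≈ F * E (n ℕ.+ a)
  zcoeff-monomial F zero {E} a = zcoeff-constant F E a
  zcoeff-monomial F (suc n) {E} a = begin
    zcoeff (0Λ ∷ monomial F n) E a   ≈⟨ zcoeff-0∷ (monomial F n) a ⟩
    zcoeff (monomial F n) E (suc a)  ≈⟨ zcoeff-monomial F n (suc a) ⟩
    F * E (n ℕ.+ suc a)              ≡⟨ cong (λ b → F * E b) (ℕₚ.+-suc n a) ⟩
    F * E (suc n ℕ.+ a)              ∎

  zcoeff-* : ∀ Φ Ψ {E} a → zcoeff (Φ *ₚ Ψ) E a ≈ zcoeff Φ (zcoeff Ψ E) a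
  zcoeff-* []      Ψ a = refl
  zcoeff-* (F ∷ Φ) Ψ {E} a = begin
    zcoeff (map (F *_) Ψ +ₚ (0Λ ∷ Φ *ₚ Ψ)) E a
      ≈⟨ zcoeff-+ (map (F *_) Ψ) _ a ⟩
    zcoeff (map (F *_) Ψ) E a + zcoeff (0Λ ∷ Φ *ₚ Ψ) E a
      ≈⟨ +-cong (zcoeff-map-* F Ψ a) (trans (zcoeff-0∷ (Φ *ₚ Ψ) a) (zcoeff-* Φ Ψ (suc a))) ⟩
    F * zcoeff Ψ E a + zcoeff Φ (zcoeff Ψ E) (suc a) ∎

  -- `F ∷ Φ` acts as multiplication by `F` plus a shifted action of `Φ`, while the action of `Ψ` is
  -- Λ-linear and commutes with shifts.
  zcoeff-comm : ∀ Φ Ψ {E} a → zcoeff Φ (zcoeff Ψ E) a ≈ zcoeff Ψ (zcoeff Φ E) a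
  zcoeff-comm []      Ψ a = sym (zcoeff-0ʳ Ψ a)
  zcoeff-comm (F ∷ Φ) Ψ {E} a = begin
    F * zcoeff Ψ E a + zcoeff Φ (zcoeff Ψ E) (suc a)
      ≈⟨ +-cong (sym (zcoeff-*ʳ Ψ F a)) (trans (zcoeff-comm Φ Ψ (suc a)) (sym (zcoeff-suc Ψ a))) ⟩
    zcoeff Ψ (λ b → F * E b) a + zcoeff Ψ (zcoeff Φ E ∘ suc) a
      ≈⟨ zcoeff-+ʳ Ψ a ⟨
    zcoeff Ψ (zcoeff (F ∷ Φ) E) a ∎

  -- Comparing elements of Λ[z⁻¹] by their action on coefficient sequences turns
  -- multiplication into composition, so that the ring laws come almost for free.
  infix 4 _∼_
  record _∼_ (Φ Ψ : Λ[z⁻¹].Poly) : Set where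
    constructor ∼-intro
    field zcoeff-≈ : ∀ {E} a → zcoeff Φ E a ≈ zcoeff Ψ E a
  open _∼_ public

  Λ[z⁻¹]-commutativeRing : CommutativeRing 0ℓ 0ℓ
  Λ[z⁻¹]-commutativeRing = record
    { Carrier = Λ[z⁻¹].Poly
    ; _≈_     = _∼_
    ; _+_     = _+ₚ_
    ; _*_     = _*ₚ_
    ; -_      = map -_
    ; 0#      = []
    ; 1#      = constant 1Λ
    ; isCommutativeRing = record
      { isRing = record
        { +-isAbelianGroup = record
          { isGroup = record
            { isMonoid = record
              { isSemigroup = record
                { isMagma = record
                  { isEquivalence = record
                    { refl  = ∼-intro λ a → refl
                    ; sym   = λ p → ∼-intro λ a → sym (zcoeff-≈ p a)
                    ; trans = λ p q → ∼-intro λ a → trans (zcoeff-≈ p a) (zcoeff-≈ q a)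
                    }
                  ; ∙-cong = λ {Φ} {Φ′} {Ψ} {Ψ′} p q → ∼-intro λ a →
                      via (zcoeff-+ Φ Ψ a) (zcoeff-+ Φ′ Ψ′ a) (+-cong (zcoeff-≈ p a) (zcoeff-≈ q a))
                  }
                ; assoc = λ Φ Ψ Ω → ∼-intro λ a →
                    via (trans (zcoeff-+ (Φ +ₚ Ψ) Ω a) (+-congʳ (zcoeff-+ Φ Ψ a)))
                        (trans (zcoeff-+ Φ (Ψ +ₚ Ω) a) (+-congˡ (zcoeff-+ Ψ Ω a)))
                        (+-assoc _ _ _)
                }
              ; identity = (λ Φ → ∼-intro λ a → refl)
                         , λ Φ → ∼-intro λ a → trans (zcoeff-+ Φ [] a) (+-identityʳ _)
              }
            ; inverse = (λ Φ → ∼-intro λ a → trans (zcoeff-+ (map -_ Φ) Φ a)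
                            (trans (+-congʳ (zcoeff-neg Φ a)) (-‿inverseˡ _)))
                      , (λ Φ → ∼-intro λ a → trans (zcoeff-+ Φ (map -_ Φ) a)
                            (trans (+-congˡ (zcoeff-neg Φ a)) (-‿inverseʳ _)))
            ; ⁻¹-cong = λ {Φ} {Ψ} p → ∼-intro λ a →
                via (zcoeff-neg Φ a) (zcoeff-neg Ψ a) (-‿cong (zcoeff-≈ p a))
            }
          ; comm = λ Φ Ψ → ∼-intro λ a → via (zcoeff-+ Φ Ψ a) (zcoeff-+ Ψ Φ a) (+-comm _ _)
          }
        ; *-cong = λ {Φ} {Φ′} {Ψ} {Ψ′} p q → ∼-intro λ a →
            via (zcoeff-* Φ Ψ a) (zcoeff-* Φ′ Ψ′ a)
                (trans (zcoeff-≈ p a) (zcoeff-cong Φ′ (zcoeff-≈ q) a))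
        ; *-assoc = λ Φ Ψ Ω → ∼-intro λ a →
            via (trans (zcoeff-* (Φ *ₚ Ψ) Ω a) (zcoeff-* Φ Ψ a))
                (trans (zcoeff-* Φ (Ψ *ₚ Ω) a) (zcoeff-cong Φ (zcoeff-* Ψ Ω) a))
                refl
        ; *-identity = (λ Φ → ∼-intro λ {E} a →
                          trans (zcoeff-* (constant 1Λ) Φ a) (zcoeff-1 (zcoeff Φ E) a))
                     , (λ Φ → ∼-intro λ {E} a →
                          trans (zcoeff-* Φ (constant 1Λ) a) (zcoeff-cong Φ (zcoeff-1 E) a))
        ; distrib = (λ Φ Ψ Ω → ∼-intro λ a →
                       via (trans (zcoeff-* Φ (Ψ +ₚ Ω) a) (zcoeff-cong Φ (zcoeff-+ Ψ Ω) a))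
                           (trans (zcoeff-+ (Φ *ₚ Ψ) (Φ *ₚ Ω) a)
                                  (+-cong (zcoeff-* Φ Ψ a) (zcoeff-* Φ Ω a)))
                           (zcoeff-+ʳ Φ a))
                  , (λ Φ Ψ Ω → ∼-intro λ a →
                       via (trans (zcoeff-* (Ψ +ₚ Ω) Φ a) (zcoeff-+ Ψ Ω a))
                           (trans (zcoeff-+ (Ψ *ₚ Φ) (Ω *ₚ Φ) a)
                                  (+-cong (zcoeff-* Ψ Φ a) (zcoeff-* Ω Φ a)))
                           refl)
        }
      ; *-comm = λ Φ Ψ → ∼-intro λ a →
          via (zcoeff-* Φ Ψ a) (zcoeff-* Ψ Φ a) (zcoeff-comm Φ Ψ a)
      }
    }
    where
    via : ∀ {x x′ y y′} → x ≈ x′ → y ≈ y′ → x′ ≈ y′ → x ≈ y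
    via x≈x′ y≈y′ x′≈y′ = trans x≈x′ (trans x′≈y′ (sym y≈y′))

module _ where
  open Λ[z⁻¹] using (_+ₚ_; _*ₚ_; constant; monomial)

  private module A = CommutativeRing Λ[z⁻¹]-commutativeRing

  -- The substitution X ↦ X + ε(1 - q)/z

  constant-isRingHomomorphism : IsRingHomomorphism Λ-rawRing A.rawRing constant
  constant-isRingHomomorphism = record
    { isSemiringHomomorphism = record
      { isNearSemiringHomomorphism = record
        { +-isMonoidHomomorphism = record
          { isMagmaHomomorphism = record
            { isRelHomomorphism = record { cong = λ F≈G → ∼-intro λ {E} a → Λᴿ.+-congʳ (⊗-cong F≈G (≈-refl {E a})) }
            ; homo = λ F G → A.refl {constant (F ⊕ G)}
            }
          ; ε-homo = ∼-intro λ {E} a → ≈-trans (zcoeff-constant 0Λ E a) (Λᴿ.zeroˡ _)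
          }
        ; *-homo = λ F G → ∼-intro λ {E} a → ≈-trans (zcoeff-constant (F ⊗ G) E a)
            (≈-trans (⊗-assoc F G (E a))
              (≈-sym (≈-trans (zcoeff-* (constant F) (constant G) {E} a)
                (≈-trans (zcoeff-constant F (zcoeff (constant G) E) a)
                  (⊗-cong ≈-refl (zcoeff-constant G E a))))))
        }
      ; 1#-homo = A.refl {constant 1Λ}
      }
    ; -‿homo = λ F → A.refl {constant (⊖ F)}
    }

  private module ι = IsRingHomomorphism constant-isRingHomomorphism

  Ψ : Λ → Λ[z⁻¹].Poly
  Ψ = extend A.rawRing (constant ∘ con)
        (λ k → constant (p₁₊ k) +ₚ monomial (con (p[ε⟨1-q⟩] (suc k))) (suc k))

  -- The two sides extend over raw rings that differ only in their equality, which
  -- blocks conversion at a variable F.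
  Ψ-≡ : ∀ F → F [X+ε⟨1-q⟩/z] ≡ Ψ F
  Ψ-≡ (con f) = ≡.refl
  Ψ-≡ (p₁₊ k) = ≡.refl
  Ψ-≡ (F ⊕ G) = cong₂ _+ₚ_ (Ψ-≡ F) (Ψ-≡ G)
  Ψ-≡ (F ⊗ G) = cong₂ _*ₚ_ (Ψ-≡ F) (Ψ-≡ G)
  Ψ-≡ (⊖ F)   = cong (map ⊖_) (Ψ-≡ F)

  Ψ-isRingHomomorphism : IsRingHomomorphism Λ-rawRing A.rawRing Ψ
  Ψ-isRingHomomorphism = extend-isRingHomomorphism Λ[z⁻¹]-commutativeRing
    (λ f≈g → ι.⟦⟧-cong (con-cong f≈g))
    (λ f g → ι.⟦⟧-cong (con-+ f g))
    (λ f g → A.trans (ι.⟦⟧-cong (con-* f g)) (ι.*-homo (con f) (con g)))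
    ι.0#-homo
    (A.refl {constant 1Λ})

  open Convolution Λ[z⁻¹]-commutativeRing
  open import Algebra.Properties.Semiring.Exp A.semiring using (_^_; ^-congˡ)
  import Algebra.Properties.Semiring.Exp Λᴿ.semiring as Λ-Exp

  z⁻¹ : Λ[z⁻¹].Poly
  z⁻¹ = monomial 1Λ 1

  zcoeff-z⁻¹ : ∀ E a → zcoeff z⁻¹ E a ≈ E (suc a)
  zcoeff-z⁻¹ E a = ≈-trans (zcoeff-monomial 1Λ 1 {E} a) (⊗-identityˡ _)

  zcoeff-z⁻¹^ : ∀ k E a → zcoeff (z⁻¹ ^ k) E a ≈ E (k ℕ.+ a)
  zcoeff-z⁻¹^ zero    E a = zcoeff-1 E a
  zcoeff-z⁻¹^ (suc k) E a = begin
    zcoeff (z⁻¹ *ₚ z⁻¹ ^ k) E a          ≈⟨ zcoeff-* z⁻¹ (z⁻¹ ^ k) a ⟩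
    zcoeff z⁻¹ (zcoeff (z⁻¹ ^ k) E) a    ≈⟨ zcoeff-z⁻¹ (zcoeff (z⁻¹ ^ k) E) a ⟩
    zcoeff (z⁻¹ ^ k) E (suc a)           ≈⟨ zcoeff-z⁻¹^ k E (suc a) ⟩
    E (k ℕ.+ suc a)                      ≡⟨ cong E (ℕₚ.+-suc k a) ⟩
    E (suc k ℕ.+ a)                      ∎
    where open import Relation.Binary.Reasoning.Setoid Λᴿ.setoid

  monomial-∼ : ∀ F k → monomial F k ∼ constant F *ₚ z⁻¹ ^ k
  monomial-∼ F k = ∼-intro λ {E} a → begin
    zcoeff (monomial F k) E a                   ≈⟨ zcoeff-monomial F k a ⟩
    F ⊗ E (k ℕ.+ a)                             ≈⟨ ⊗-cong ≈-refl (zcoeff-z⁻¹^ k E a) ⟨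
    F ⊗ zcoeff (z⁻¹ ^ k) E a                    ≈⟨ zcoeff-constant F (zcoeff (z⁻¹ ^ k) E) a ⟨
    zcoeff (constant F) (zcoeff (z⁻¹ ^ k) E) a  ≈⟨ zcoeff-* (constant F) (z⁻¹ ^ k) a ⟨
    zcoeff (constant F *ₚ z⁻¹ ^ k) E a          ∎
    where open import Relation.Binary.Reasoning.Setoid Λᴿ.setoid

  private
    ⟨q-1⟩/z : Λ[z⁻¹].Poly
    ⟨q-1⟩/z = constant (𝐪 ⊕ ⊖ 1Λ) *ₚ z⁻¹

    -- With x = 1/z and d = (q - 1)/z, the parameter x + d of `K` and `H` is q/z, which has its
    -- coefficient in the cone.
    z⁻¹+⟨q-1⟩/z : z⁻¹ +ₚ ⟨q-1⟩/z ∼ constant 𝐪 *ₚ z⁻¹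
    z⁻¹+⟨q-1⟩/z = ∼-intro λ {E} a → begin
      zcoeff (z⁻¹ +ₚ ⟨q-1⟩/z) E a
        ≈⟨ zcoeff-+ z⁻¹ ⟨q-1⟩/z {E} a ⟩
      zcoeff z⁻¹ E a ⊕ zcoeff ⟨q-1⟩/z E a
        ≈⟨ ⊕-cong (zcoeff-z⁻¹ E a) (zcoeff-∙z⁻¹ (𝐪 ⊕ ⊖ 1Λ) E a) ⟩
      E (suc a) ⊕ (𝐪 ⊕ ⊖ 1Λ) ⊗ E (suc a)
        ≈⟨ ⊕-cong ≈-refl (≈-trans (⊗-distribʳ _ _ _) (⊕-cong ≈-refl (-1*x≈-x _))) ⟩
      E (suc a) ⊕ (𝐪 ⊗ E (suc a) ⊕ ⊖ E (suc a))
        ≈⟨ ≈-trans (≈-sym (⊕-assoc _ _ _)) (xyx⁻¹≈y _ _) ⟩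
      𝐪 ⊗ E (suc a)
        ≈⟨ zcoeff-∙z⁻¹ 𝐪 E a ⟨
      zcoeff (constant 𝐪 *ₚ z⁻¹) E a ∎
      where
      open import Relation.Binary.Reasoning.Setoid Λᴿ.setoid
      open import Algebra.Properties.Ring Λᴿ.ring using (-1*x≈-x)
      open import Algebra.Properties.AbelianGroup Λᴿ.+-abelianGroup using (xyx⁻¹≈y)
      zcoeff-∙z⁻¹ : ∀ F E a → zcoeff (constant F *ₚ z⁻¹) E a ≈ F ⊗ E (suc a)
      zcoeff-∙z⁻¹ F E a = ≈-trans (zcoeff-* (constant F) z⁻¹ {E} a)
        (≈-trans (zcoeff-constant F (zcoeff z⁻¹ E) a) (⊗-cong ≈-refl (zcoeff-z⁻¹ E a)))

  -- Using d rather than x + d as a parameter keeps the factor q - 1 visible, so that positivity can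
  -- be read off the recursion.
  K⟨q⟩ H⟨q⟩ : ℕ → Λ[z⁻¹].Poly
  K⟨q⟩ = K (constant ∘ e) z⁻¹ ⟨q-1⟩/z
  H⟨q⟩ = H (constant ∘ e) z⁻¹ ⟨q-1⟩/z

  signed-Ψ : ∀ i → signedₕ Λ[z⁻¹]-commutativeRing Ψ-isRingHomomorphism i +ₚ z⁻¹ ^ suc i
                 ∼ signedₕ Λ[z⁻¹]-commutativeRing constant-isRingHomomorphism i +ₚ (z⁻¹ +ₚ ⟨q-1⟩/z) ^ suc i
  signed-Ψ i = begin
    s *ₚ (constant (p₁₊ i) +ₚ monomial c k) +ₚ z⁻¹ ^ k
      ≈⟨ A.+-congʳ {z⁻¹ ^ k} (A.*-congˡ {s} (A.+-congˡ {constant (p₁₊ i)} (A.trans (monomial-∼ c k) (A.*-congʳ {z⁻¹ ^ k} c∼)))) ⟩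
    s *ₚ (constant (p₁₊ i) +ₚ ((A.- A.1#) ^ k *ₚ (A.1# +ₚ A.- (constant 𝐪 ^ k))) *ₚ z⁻¹ ^ k) +ₚ z⁻¹ ^ k
      ≈⟨ Signs.signed-shift Λ[z⁻¹]-commutativeRing i (constant (p₁₊ i)) (constant 𝐪) z⁻¹ ⟩
    s *ₚ constant (p₁₊ i) +ₚ (constant 𝐪 *ₚ z⁻¹) ^ k
      ≈⟨ A.+-congˡ {s *ₚ constant (p₁₊ i)} (^-congˡ k z⁻¹+⟨q-1⟩/z) ⟨
    s *ₚ constant (p₁₊ i) +ₚ (z⁻¹ +ₚ ⟨q-1⟩/z) ^ k ∎
    where
    open import Relation.Binary.Reasoning.Setoid A.setoid
    k = suc i
    s = (A.- A.1#) ^ i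
    c = con (p[ε⟨1-q⟩] k)
    ι-^ = homo-^ Λ[z⁻¹]-commutativeRing constant-isRingHomomorphism
    c∼ : constant c ∼ (A.- A.1#) ^ k *ₚ (A.1# +ₚ A.- (constant 𝐪 ^ k))
    c∼ = begin
      constant c
        ≈⟨ ι.⟦⟧-cong (con-p[ε⟨1-q⟩] k) ⟩
      constant ((⊖ 1Λ) Λ-Exp.^ k ⊗ (1Λ ⊕ ⊖ (𝐪 Λ-Exp.^ k)))
        ≈⟨ ι.*-homo ((⊖ 1Λ) Λ-Exp.^ k) (1Λ ⊕ ⊖ (𝐪 Λ-Exp.^ k)) ⟩
      constant ((⊖ 1Λ) Λ-Exp.^ k) *ₚ (A.1# +ₚ A.- (constant (𝐪 Λ-Exp.^ k)))
        ≈⟨ A.*-cong (ι-^ (⊖ 1Λ) k) (A.+-congˡ {A.1#} (A.-‿cong (ι-^ 𝐪 k))) ⟩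
      (A.- A.1#) ^ k *ₚ (A.1# +ₚ A.- (constant 𝐪 ^ k)) ∎

  -- Both sequences start with 1 and satisfy Newton's identities for the power sums of X + ε(1 -
  -- q)/z; `signed-Ψ` supplies the comparison of power sums that `H-newton` asks for.
  Ψ-e : ∀ n → Ψ (e n) ∼ H⟨q⟩ n
  Ψ-e = newton-unique
    (λ n → Ψ (con (ℚ[q].constant (+ 1 ℚ./ suc n)))) (homo-1/n Λ[z⁻¹]-commutativeRing Ψ-isRingHomomorphism)
    (A.refl {constant 1Λ})
    (newton Λ[z⁻¹]-commutativeRing Ψ-isRingHomomorphism)
    (H-newton (constant ∘ e) z⁻¹ ⟨q-1⟩/z
      {P = signedₕ Λ[z⁻¹]-commutativeRing constant-isRingHomomorphism}
      (newton Λ[z⁻¹]-commutativeRing constant-isRingHomomorphism)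
      signed-Ψ)

  -- The graded cone and its stability under B

  data Positive : ℕ → Λ → Set where
    resp : ∀ {n F G} → F ≈ G → Positive n F → Positive n G
    0ᵖ   : ∀ {n} → Positive n 0Λ
    qᵖ   : Positive 0 𝐪
    q-1ᵖ : Positive 0 (𝐪 ⊕ ⊖ 1Λ)
    -- The unit of the cone is the case n = 0.
    eᵖ   : ∀ n → Positive n (e n)
    +ᵖ   : ∀ {n F G} → Positive n F → Positive n G → Positive n (F ⊕ G)
    *ᵖ   : ∀ {m n F G} → Positive m F → Positive n G → Positive (m ℕ.+ n) (F ⊗ G)

  -- Φ is homogeneous of degree n, with 1/z of degree 1, and has coefficients in
  -- the cone.  The shift m of the degrees lets products act by composition.
  Positiveᶻ : ℕ → Λ[z⁻¹].Poly → Set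
  Positiveᶻ n Φ = ∀ m E → (∀ r → Positive (r ℕ.+ m) (E r)) → ∀ a → Positive (a ℕ.+ (m ℕ.+ n)) (zcoeff Φ E a)

  module _ where
    open ≡ using (subst; sym; trans)

    respᶻ : ∀ {n Φ Θ} → Φ ∼ Θ → Positiveᶻ n Φ → Positiveᶻ n Θ
    respᶻ p pos m E E-pos a = resp (zcoeff-≈ p a) (pos m E E-pos a)

    constantᶻ : ∀ {n F} → Positive n F → Positiveᶻ n (constant F)
    constantᶻ {n} {F} pos m E E-pos a = subst (λ k → Positive k (zcoeff (constant F) E a))
      (trans (ℕₚ.+-comm n (a ℕ.+ m)) (ℕₚ.+-assoc a m n))
      (resp (≈-sym (zcoeff-constant F E a)) (*ᵖ pos (E-pos a)))

    +ᶻ : ∀ {n Φ Θ} → Positiveᶻ n Φ → Positiveᶻ n Θ → Positiveᶻ n (Φ +ₚ Θ)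
    +ᶻ {Φ = Φ} {Θ} posΦ posΘ m E E-pos a =
      resp (≈-sym (zcoeff-+ Φ Θ a)) (+ᵖ (posΦ m E E-pos a) (posΘ m E E-pos a))

    -- A product acts by composition: `Θ` raises the shift from m to m + n, and `Φ` then acts on the
    -- resulting sequence.
    *ᶻ : ∀ {k n Φ Θ} → Positiveᶻ k Φ → Positiveᶻ n Θ → Positiveᶻ (k ℕ.+ n) (Φ *ₚ Θ)
    *ᶻ {k} {n} {Φ} {Θ} posΦ posΘ m E E-pos a =
      subst (λ j → Positive (a ℕ.+ j) (zcoeff (Φ *ₚ Θ) E a))
        (trans (ℕₚ.+-assoc m n k) (cong (m ℕ.+_) (ℕₚ.+-comm n k)))
        (resp (≈-sym (zcoeff-* Φ Θ a)) (posΦ (m ℕ.+ n) (zcoeff Θ E) (posΘ m E E-pos) a))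

    z⁻¹ᶻ : Positiveᶻ 1 z⁻¹
    z⁻¹ᶻ m E E-pos a = subst (λ j → Positive j (zcoeff z⁻¹ E a))
      (trans (sym (ℕₚ.+-suc a m)) (cong (a ℕ.+_) (ℕₚ.+-comm 1 m)))
      (resp (≈-sym (zcoeff-z⁻¹ E a)) (E-pos (suc a)))

  K⟨q⟩ᶻ : ∀ n → Positiveᶻ n (K⟨q⟩ n)
  K⟨q⟩ᶻ zero    = constantᶻ (eᵖ 0)
  K⟨q⟩ᶻ (suc n) = +ᶻ {Φ = constant (e (suc n))} (constantᶻ (eᵖ (suc n)))
    (*ᶻ {Φ = z⁻¹ +ₚ ⟨q-1⟩/z} {K⟨q⟩ n}
      (respᶻ (A.sym z⁻¹+⟨q-1⟩/z) (*ᶻ {Φ = constant 𝐪} {z⁻¹} (constantᶻ qᵖ) z⁻¹ᶻ)) (K⟨q⟩ᶻ n))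

  H⟨q⟩ᶻ : ∀ n → Positiveᶻ n (H⟨q⟩ n)
  H⟨q⟩ᶻ zero    = constantᶻ (eᵖ 0)
  H⟨q⟩ᶻ (suc n) = +ᶻ {Φ = constant (e (suc n))} (constantᶻ (eᵖ (suc n)))
    (*ᶻ {Φ = ⟨q-1⟩/z} {K⟨q⟩ n} (*ᶻ {Φ = constant (𝐪 ⊕ ⊖ 1Λ)} {z⁻¹} (constantᶻ q-1ᵖ) z⁻¹ᶻ) (K⟨q⟩ᶻ n))

  private module Ψₕ = IsRingHomomorphism Ψ-isRingHomomorphism

  Ψᶻ : ∀ {n F} → Positive n F → Positiveᶻ n (Ψ F)
  Ψᶻ (resp F≈G pos)         = respᶻ (Ψₕ.⟦⟧-cong F≈G) (Ψᶻ pos)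
  Ψᶻ 0ᵖ                     = constantᶻ 0ᵖ
  Ψᶻ qᵖ                     = constantᶻ qᵖ
  Ψᶻ q-1ᵖ                   = constantᶻ q-1ᵖ
  Ψᶻ (eᵖ n)                 = respᶻ (A.sym (Ψ-e n)) (H⟨q⟩ᶻ n)
  Ψᶻ (+ᵖ {F = F} {G} p₁ p₂) = +ᶻ {Φ = Ψ F} {Ψ G} (Ψᶻ p₁) (Ψᶻ p₂)
  Ψᶻ (*ᵖ {F = F} {G} p₁ p₂) = *ᶻ {Φ = Ψ F} {Ψ G} (Ψᶻ p₁) (Ψᶻ p₂)

  Bᵖ : ∀ a {n F} → Positive n F → Positive (a ℕ.+ n) (B a F)
  Bᵖ a {n} {F} pos = ≡.subst (λ Φ → Positive (a ℕ.+ n) (zcoeff Φ e a)) (≡.sym (Ψ-≡ F))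
    -- The multiplier sequence is `e` itself, with `e r` of degree r, hence shift 0.
    (Ψᶻ pos 0 e (λ r → ≡.subst (λ k → Positive k (e r)) (≡.sym (ℕₚ.+-identityʳ r)) (eᵖ r)) a)

  B[_]1ᵖ : ∀ p → Positive (sum p) B[ p ]1
  B[ []    ]1ᵖ = eᵖ 0
  B[ a ∷ p ]1ᵖ = Bᵖ a B[ p ]1ᵖ

open ℚ[q] using (coeffwise; coeff; constant; _+ₚ_; _*ₚ_; _∘ₚ_)
open ℚ[q]._≈ₚ_ using (coeff-≈)
open import Algebra.Properties.Semiring.Exp Λᴿ.semiring using (_^_; ^-homo-*)
open import Algebra.Solver.Ring.NaturalCoefficients.Default Λᴿ.commutativeSemiring
  using (solve; _:=_; _:+_; _:*_)

-- The substitution q ↦ 1 + q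

-- One Horner step. The laws of composition are stated after `con`, so that the calculations use the
-- ring laws and the solver of `Λ` instead of manipulating coefficient lists.
con-∘ₚ-∷ : ∀ a f g → con ((a ∷ f) ∘ₚ g) ≈ con (constant a) ⊕ con g ⊗ con (f ∘ₚ g)
con-∘ₚ-∷ a f g = ≈-trans (con-+ (constant a) (g *ₚ (f ∘ₚ g))) (⊕-cong ≈-refl (con-* g (f ∘ₚ g)))

module _ (g : ℚ[q]) where

  open import Relation.Binary.Reasoning.Setoid Λᴿ.setoid

  -- Equal polynomials may differ by trailing zeros. This disposes of the excess when `con-∘ₚ-cong`
  -- compares lists of different lengths.
  con-∘ₚ-≈0 : ∀ f → f 𝕂.≈ [] → con (f ∘ₚ g) ≈ 0Λ
  con-∘ₚ-≈0 []      f≈0 = ≈-refl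
  con-∘ₚ-≈0 (a ∷ f) f≈0 = begin
    con ((a ∷ f) ∘ₚ g)                        ≈⟨ con-∘ₚ-∷ a f g ⟩
    con (constant a) ⊕ con g ⊗ con (f ∘ₚ g)   ≈⟨ ⊕-cong a≈0 (⊗-cong ≈-refl (con-∘ₚ-≈0 f (coeffwise (coeff-≈ f≈0 ∘ suc)))) ⟩
    0Λ ⊕ con g ⊗ 0Λ                           ≈⟨ ≈-trans (⊕-identityˡ _) (Λᴿ.zeroʳ _) ⟩
    0Λ                                        ∎
    where
    a≈0 : con (constant a) ≈ 0Λ
    a≈0 = ≈-trans (Λᴿ.reflexive (cong (con ∘ constant) (coeff-≈ f≈0 0))) con-constant-0

  con-∘ₚ-cong : ∀ f f′ → f 𝕂.≈ f′ → con (f ∘ₚ g) ≈ con (f′ ∘ₚ g)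
  con-∘ₚ-cong f        []       f≈f′ = con-∘ₚ-≈0 f f≈f′
  con-∘ₚ-cong []       (b ∷ f′) f≈f′ = ≈-sym (con-∘ₚ-≈0 (b ∷ f′) (coeffwise (≡.sym ∘ coeff-≈ f≈f′)))
  con-∘ₚ-cong (a ∷ f)  (b ∷ f′) f≈f′ = begin
    con ((a ∷ f) ∘ₚ g)                         ≈⟨ con-∘ₚ-∷ a f g ⟩
    con (constant a) ⊕ con g ⊗ con (f ∘ₚ g)    ≈⟨ ⊕-cong (Λᴿ.reflexive (cong (con ∘ constant) (coeff-≈ f≈f′ 0)))
                                                    (⊗-cong ≈-refl (con-∘ₚ-cong f f′ (coeffwise (coeff-≈ f≈f′ ∘ suc)))) ⟩
    con (constant b) ⊕ con g ⊗ con (f′ ∘ₚ g)   ≈⟨ con-∘ₚ-∷ b f′ g ⟨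
    con ((b ∷ f′) ∘ₚ g)                        ∎

  con-∘ₚ-+ : ∀ f f′ → con ((f +ₚ f′) ∘ₚ g) ≈ con (f ∘ₚ g) ⊕ con (f′ ∘ₚ g)
  con-∘ₚ-+ []      f′       = ≈-sym (⊕-identityˡ _)
  con-∘ₚ-+ (a ∷ f) []       = ≈-sym (Λᴿ.+-identityʳ _)
  con-∘ₚ-+ (a ∷ f) (b ∷ f′) = begin
    con ((a ℚ.+ b ∷ f +ₚ f′) ∘ₚ g)
      ≈⟨ con-∘ₚ-∷ (a ℚ.+ b) (f +ₚ f′) g ⟩
    con (constant (a ℚ.+ b)) ⊕ con g ⊗ con ((f +ₚ f′) ∘ₚ g)
      ≈⟨ ⊕-cong (con-+ (constant a) (constant b)) (⊗-cong ≈-refl (con-∘ₚ-+ f f′)) ⟩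
    (con (constant a) ⊕ con (constant b)) ⊕ con g ⊗ (con (f ∘ₚ g) ⊕ con (f′ ∘ₚ g))
      ≈⟨ solve 5 (λ a b x y z → (a :+ b) :+ x :* (y :+ z) := (a :+ x :* y) :+ (b :+ x :* z)) ≈-refl _ _ _ _ _ ⟩
    (con (constant a) ⊕ con g ⊗ con (f ∘ₚ g)) ⊕ (con (constant b) ⊕ con g ⊗ con (f′ ∘ₚ g))
      ≈⟨ ⊕-cong (con-∘ₚ-∷ a f g) (con-∘ₚ-∷ b f′ g) ⟨
    con ((a ∷ f) ∘ₚ g) ⊕ con ((b ∷ f′) ∘ₚ g) ∎

  con-∘ₚ-map-* : ∀ a f → con (map (a ℚ.*_) f ∘ₚ g) ≈ con (constant a) ⊗ con (f ∘ₚ g)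
  con-∘ₚ-map-* a []      = ≈-sym (Λᴿ.zeroʳ _)
  con-∘ₚ-map-* a (b ∷ f) = begin
    con ((a ℚ.* b ∷ map (a ℚ.*_) f) ∘ₚ g)
      ≈⟨ con-∘ₚ-∷ (a ℚ.* b) (map (a ℚ.*_) f) g ⟩
    con (constant (a ℚ.* b)) ⊕ con g ⊗ con (map (a ℚ.*_) f ∘ₚ g)
      ≈⟨ ⊕-cong (con-constant-* a b) (⊗-cong ≈-refl (con-∘ₚ-map-* a f)) ⟩
    con (constant a) ⊗ con (constant b) ⊕ con g ⊗ (con (constant a) ⊗ con (f ∘ₚ g))
      ≈⟨ solve 4 (λ a b x y → a :* b :+ x :* (a :* y) := a :* (b :+ x :* y)) ≈-refl _ _ _ _ ⟩
    con (constant a) ⊗ (con (constant b) ⊕ con g ⊗ con (f ∘ₚ g))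
      ≈⟨ ⊗-cong ≈-refl (con-∘ₚ-∷ b f g) ⟨
    con (constant a) ⊗ con ((b ∷ f) ∘ₚ g) ∎

  con-∘ₚ-* : ∀ f f′ → con ((f *ₚ f′) ∘ₚ g) ≈ con (f ∘ₚ g) ⊗ con (f′ ∘ₚ g)
  con-∘ₚ-* []      f′ = ≈-sym (Λᴿ.zeroˡ _)
  con-∘ₚ-* (a ∷ f) f′ = begin
    con ((map (a ℚ.*_) f′ +ₚ (ℚ.0ℚ ∷ f *ₚ f′)) ∘ₚ g)
      ≈⟨ con-∘ₚ-+ (map (a ℚ.*_) f′) (ℚ.0ℚ ∷ f *ₚ f′) ⟩
    con (map (a ℚ.*_) f′ ∘ₚ g) ⊕ con ((ℚ.0ℚ ∷ f *ₚ f′) ∘ₚ g)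
      ≈⟨ ⊕-cong (con-∘ₚ-map-* a f′) (con-∘ₚ-∷ ℚ.0ℚ (f *ₚ f′) g) ⟩
    con (constant a) ⊗ con (f′ ∘ₚ g) ⊕ (con (constant ℚ.0ℚ) ⊕ con g ⊗ con ((f *ₚ f′) ∘ₚ g))
      ≈⟨ ⊕-cong ≈-refl (≈-trans (⊕-cong con-constant-0 (⊗-cong ≈-refl (con-∘ₚ-* f f′))) (⊕-identityˡ _)) ⟩
    con (constant a) ⊗ con (f′ ∘ₚ g) ⊕ con g ⊗ (con (f ∘ₚ g) ⊗ con (f′ ∘ₚ g))
      ≈⟨ solve 4 (λ a b x y → a :* b :+ x :* (y :* b) := (a :+ x :* y) :* b) ≈-refl _ _ _ _ ⟩
    (con (constant a) ⊕ con g ⊗ con (f ∘ₚ g)) ⊗ con (f′ ∘ₚ g)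
      ≈⟨ ⊗-cong (con-∘ₚ-∷ a f g) ≈-refl ⟨
    con ((a ∷ f) ∘ₚ g) ⊗ con (f′ ∘ₚ g) ∎

  con-constant-∘ₚ : ∀ a → con (constant a ∘ₚ g) ≈ con (constant a)
  con-constant-∘ₚ a = begin
    con (constant a ∘ₚ g)          ≈⟨ con-∘ₚ-∷ a [] g ⟩
    con (constant a) ⊕ con g ⊗ 0Λ  ≈⟨ Λᴿ.+-congˡ (Λᴿ.zeroʳ _) ⟩
    con (constant a) ⊕ 0Λ          ≈⟨ Λᴿ.+-identityʳ _ ⟩
    con (constant a)               ∎

∣q→1+q-isRingHomomorphism : IsRingHomomorphism Λ-rawRing Λ-rawRing _∣q→1+q
∣q→1+q-isRingHomomorphism = extend-isRingHomomorphism Λ-commutativeRing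
  (λ {f} {f′} → con-∘ₚ-cong 1+q f f′) (con-∘ₚ-+ 1+q) (con-∘ₚ-* 1+q) ≈-refl (con-constant-∘ₚ 1+q ℚ.1ℚ)
  where 1+q = 𝕂.1# 𝕂.+ q

private module shift = IsRingHomomorphism ∣q→1+q-isRingHomomorphism

mutual
  -- Newton's recursion builds `e n` from power sums and rational constants, all fixed by the
  -- substitution.
  e-∣q→1+q : ∀ n → e n ∣q→1+q ≈ e n
  e-∣q→1+q zero    = shift.1#-homo
  e-∣q→1+q (suc n) = ⊗-cong (con-constant-∘ₚ (𝕂.1# 𝕂.+ q) _) (alternating-∣q→1+q n 0)

  alternating-∣q→1+q : ∀ n i → alternating i (e≤ n) ∣q→1+q ≈ alternating i (e≤ n)
  alternating-∣q→1+q zero    i = ⊕-cong (⊗-cong (e-∣q→1+q 0) ≈-refl) ≈-refl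
  alternating-∣q→1+q (suc n) i =
    ⊕-cong (⊗-cong (e-∣q→1+q (suc n)) ≈-refl) (⊖-cong (alternating-∣q→1+q n (suc i)))

𝐪-∣q→1+q : 𝐪 ∣q→1+q ≈ 1Λ ⊕ 𝐪
𝐪-∣q→1+q = ≈-trans
  -- Horner evaluation leaves a trailing zero at position 2, hence the separate case.
  (con-cong (coeffwise λ { zero → ≡.refl ; 1 → ≡.refl ; (suc (suc zero)) → ≡.refl ; (suc (suc (suc n))) → ≡.refl }))
  (con-+ 𝕂.1# q)

-- Nonnegative combinations of the products of q-powers and e[ μ ]

data EPositive : ℕ → Λ → Set where
  resp      : ∀ {n F G} → F ≈ G → EPositive n F → EPositive n G
  0ᵉ        : ∀ {n} → EPositive n 0Λ
  +ᵉ        : ∀ {n F G} → EPositive n F → EPositive n G → EPositive n (F ⊕ G)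
  -- The parts may come in any order, so products simply concatenate them; sorting is left to
  -- `expansion`.
  monomialᵉ : ∀ k {μ} → All (_≥ 1) μ → EPositive (sum μ) (𝐪 ^ k ⊗ e[ μ ])

e[++] : ∀ μ ν → e[ μ ++ ν ] ≈ e[ μ ] ⊗ e[ ν ]
e[++] []      ν = ≈-sym (⊗-identityˡ _)
e[++] (m ∷ μ) ν = ≈-trans (⊗-cong ≈-refl (e[++] μ ν)) (≈-sym (⊗-assoc _ _ _))

e[↭] : ∀ {μ ν} → μ ↭ ν → e[ μ ] ≈ e[ ν ]
e[↭] Perm.refl          = ≈-refl
e[↭] (Perm.prep m p)    = ⊗-cong ≈-refl (e[↭] p)
e[↭] (Perm.swap m n p)  = ≈-trans (⊗-cong ≈-refl (⊗-cong ≈-refl (e[↭] p)))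
  (solve 3 (λ a b c → a :* (b :* c) := b :* (a :* c)) ≈-refl _ _ _)
e[↭] (Perm.trans p₁ p₂) = ≈-trans (e[↭] p₁) (e[↭] p₂)

monomial-*ᵉ : ∀ k {μ n G} → All (_≥ 1) μ → EPositive n G →
              EPositive (sum μ ℕ.+ n) ((𝐪 ^ k ⊗ e[ μ ]) ⊗ G)
monomial-*ᵉ k μ≥1 (resp F≈G p) = resp (⊗-cong ≈-refl F≈G) (monomial-*ᵉ k μ≥1 p)
monomial-*ᵉ k μ≥1 0ᵉ           = resp (≈-sym (Λᴿ.zeroʳ _)) 0ᵉ
monomial-*ᵉ k μ≥1 (+ᵉ p₁ p₂)   = resp (≈-sym (Λᴿ.distribˡ _ _ _)) (+ᵉ (monomial-*ᵉ k μ≥1 p₁) (monomial-*ᵉ k μ≥1 p₂))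
monomial-*ᵉ k {μ} μ≥1 (monomialᵉ l {ν} ν≥1) =
  ≡.subst (λ n → EPositive n ((𝐪 ^ k ⊗ e[ μ ]) ⊗ (𝐪 ^ l ⊗ e[ ν ]))) (ListAction.sum-++ μ ν)
    (resp (begin
      𝐪 ^ (k ℕ.+ l) ⊗ e[ μ ++ ν ]             ≈⟨ ⊗-cong (^-homo-* 𝐪 k l) (e[++] μ ν) ⟩
      (𝐪 ^ k ⊗ 𝐪 ^ l) ⊗ (e[ μ ] ⊗ e[ ν ])     ≈⟨ solve 4 (λ a b c d → (a :* b) :* (c :* d) := (a :* c) :* (b :* d)) ≈-refl _ _ _ _ ⟩
      (𝐪 ^ k ⊗ e[ μ ]) ⊗ (𝐪 ^ l ⊗ e[ ν ])     ∎)
      (monomialᵉ (k ℕ.+ l) (Allₚ.++⁺ μ≥1 ν≥1)))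
  where open import Relation.Binary.Reasoning.Setoid Λᴿ.setoid

*ᵉ : ∀ {m n F G} → EPositive m F → EPositive n G → EPositive (m ℕ.+ n) (F ⊗ G)
*ᵉ (resp F≈G p)      r = resp (⊗-cong F≈G ≈-refl) (*ᵉ p r)
*ᵉ 0ᵉ                r = resp (≈-sym (Λᴿ.zeroˡ _)) 0ᵉ
*ᵉ (+ᵉ p₁ p₂)        r = resp (≈-sym (⊗-distribʳ _ _ _)) (+ᵉ (*ᵉ p₁ r) (*ᵉ p₂ r))
*ᵉ (monomialᵉ k μ≥1) r = monomial-*ᵉ k μ≥1 r

-- Parts must be positive, so `e 0` is represented by the empty product and not by a part 0.
eᵉ : ∀ n → EPositive n (e n)
eᵉ zero    = resp (⊗-identityˡ _) (monomialᵉ 0 [])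
eᵉ (suc n) = ≡.subst (λ k → EPositive k (e (suc n))) (ℕₚ.+-identityʳ (suc n))
  (resp (≈-trans (⊗-identityˡ _) (Λᴿ.*-identityʳ _)) (monomialᵉ 0 (s≤s z≤n ∷ [])))

qᵉ : EPositive 0 𝐪
qᵉ = resp (≈-trans (Λᴿ.*-identityʳ _) (Λᴿ.*-identityʳ _)) (monomialᵉ 1 [])

shiftᵉ : ∀ {n F} → Positive n F → EPositive n (F ∣q→1+q)
shiftᵉ (resp F≈G p) = resp (shift.⟦⟧-cong F≈G) (shiftᵉ p)
shiftᵉ 0ᵖ           = 0ᵉ
shiftᵉ qᵖ           = resp (≈-sym 𝐪-∣q→1+q) (+ᵉ (eᵉ 0) qᵉ)
shiftᵉ q-1ᵖ         = resp (≈-sym (≈-trans (⊕-cong 𝐪-∣q→1+q (⊖-cong shift.1#-homo)) (xyx⁻¹≈y 1Λ 𝐪))) qᵉ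
  where open import Algebra.Properties.AbelianGroup Λᴿ.+-abelianGroup using (xyx⁻¹≈y)
shiftᵉ (eᵖ n)       = resp (≈-sym (e-∣q→1+q n)) (eᵉ n)
shiftᵉ (+ᵖ p₁ p₂)   = +ᵉ (shiftᵉ p₁) (shiftᵉ p₂)
shiftᵉ (*ᵖ p₁ p₂)   = *ᵉ (shiftᵉ p₁) (shiftᵉ p₂)

-- Partitions

module _ {a b} {A : Set a} {B : Set b} {f : A → List B} (g : B → A) where

  -- The map `g` recovers from an entry the block it lies in, so blocks of distinct elements are
  -- disjoint.
  concatMap-unique : ∀ {xs} → Unique xs → All (λ x → Unique (f x) ∧ All (λ y → g y ≡ x) (f x)) xs →
                     Unique (concatMap f xs)
  concatMap-unique {[]}     []                 []                       = []
  concatMap-unique {x ∷ xs} (x∉xs ∷ xs-unique) ((fx-unique , g-fx) ∷ fxs) =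
    Unique.++⁺ fx-unique (concatMap-unique xs-unique fxs) disjoint
    where
    disjoint : ∀ {y} → y ∈ f x ∧ y ∈ concatMap f xs → ⊥
    disjoint (y∈fx , y∈fxs) with find (∈-concatMap⁻ f {xs = xs} y∈fxs)
    ... | x′ , x′∈xs , y∈fx′ =
      All.lookup x∉xs x′∈xs (≡.trans (≡.sym (All.lookup g-fx y∈fx)) (All.lookup (proj₂ (All.lookup fxs x′∈xs)) y∈fx′))

-- Recovers c from every element of grow c, provided the parts of c are positive.
shrink : List ℕ → List ℕ
shrink (suc (suc a) ∷ c) = suc a ∷ c
shrink (_ ∷ c)           = c
shrink []                = []

compositions-≥1 : ∀ n → All (All (_≥ 1)) (compositions n)
compositions-≥1 zero    = [] ∷ []
compositions-≥1 (suc n) = Allₚ.concat⁺ (Allₚ.map⁺ (All.map grow-≥1 (compositions-≥1 n)))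
  where
  grow-≥1 : ∀ {c} → All (_≥ 1) c → All (All (_≥ 1)) (grow c)
  grow-≥1 []          = (s≤s z≤n ∷ []) ∷ []
  grow-≥1 (a≥1 ∷ c≥1) = (s≤s z≤n ∷ a≥1 ∷ c≥1) ∷ (s≤s z≤n ∷ c≥1) ∷ []

compositions-unique : ∀ n → Unique (compositions n)
compositions-unique zero    = [] ∷ []
compositions-unique (suc n) =
  concatMap-unique shrink (compositions-unique n) (All.map grow-unique (compositions-≥1 n))
  where
  grow-unique : ∀ {c} → All (_≥ 1) c → Unique (grow c) ∧ All (λ d → shrink d ≡ c) (grow c)
  grow-unique []                  = [] ∷ [] , ≡.refl ∷ []
  grow-unique (s≤s {n = a} _ ∷ _) = ((λ ()) ∷ []) ∷ [] ∷ [] , ≡.refl ∷ ≡.refl ∷ []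

-- The recursion undoes `grow`: a leading 1 is removed, a larger first part is lowered by one. The
-- list with the single part 1 stands apart because it grows from the empty composition.
∈-compositions : ∀ {c} → All (_≥ 1) c → c ∈ compositions (sum c)
∈-compositions []                                = here ≡.refl
∈-compositions {1 ∷ []}              (_ ∷ [])    = here ≡.refl
∈-compositions {1 ∷ b ∷ c}           (_ ∷ c≥1)   =
  ∈-concatMap⁺ grow (Any.map (λ { ≡.refl → here ≡.refl }) (∈-compositions c≥1))
∈-compositions {suc (suc a) ∷ c}     (_ ∷ c≥1)   =
  ∈-concatMap⁺ grow (Any.map (λ { ≡.refl → there (here ≡.refl) }) (∈-compositions {suc a ∷ c} (s≤s z≤n ∷ c≥1)))

-- The reversed order makes sorted lists weakly decreasing, as `partitions` demands.
open Sort (Flip.decTotalOrder ℕₚ.≤-decTotalOrder) using (sort; sort-↭; sort-↗)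

sort∈partitions : ∀ {c} → All (_≥ 1) c → sort c ∈ partitions (sum c)
sort∈partitions {c} c≥1 = ∈-filter⁺ (linked? _≥?_)
  (≡.subst (λ n → sort c ∈ compositions n) (ListAction.sum-↭ (sort-↭ c))
    (∈-compositions (All-resp-↭ (↭-sym (sort-↭ c)) c≥1)))
  (sort-↗ c)

partitions-unique : ∀ n → Unique (partitions n)
partitions-unique n = Unique.filter⁺ (linked? _≥?_) (compositions-unique n)

-- Sums over an enumeration

module _ {a} {A : Set a} where

  sumOver : List A → (A → Λ) → Λ
  sumOver xs f = sumΛ (map f xs)

  Σ-zero : ∀ {f} {xs : List A} → All (λ x → f x ≈ 0Λ) xs → sumOver xs f ≈ 0Λ
  Σ-zero []          = ≈-refl
  Σ-zero (f≈0 ∷ fs≈0) = ≈-trans (⊕-cong f≈0 (Σ-zero fs≈0)) (⊕-identityˡ _)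

  Σ-+ : ∀ {f g h} → (∀ x → f x ≈ g x ⊕ h x) → ∀ (xs : List A) → sumOver xs f ≈ sumOver xs g ⊕ sumOver xs h
  Σ-+ f≈g+h []       = ≈-sym (⊕-identityˡ _)
  Σ-+ f≈g+h (x ∷ xs) = ≈-trans (⊕-cong (f≈g+h x) (Σ-+ f≈g+h xs))
    (solve 4 (λ a b c d → (a :+ b) :+ (c :+ d) := (a :+ c) :+ (b :+ d)) ≈-refl _ _ _ _)

  -- Uniqueness ensures that the surviving term is counted once.
  Σ-single : ∀ {f} {x : A} {xs} → (∀ {y} → y ≢ x → f y ≈ 0Λ) → Unique xs → x ∈ xs → sumOver xs f ≈ f x
  Σ-single f≈0 (x∉xs ∷ _) (here ≡.refl) =
    ≈-trans (⊕-cong ≈-refl (Σ-zero (All.map (λ x≢y → f≈0 (x≢y ∘ ≡.sym)) x∉xs))) (Λᴿ.+-identityʳ _)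
  Σ-single f≈0 (y∉xs ∷ xs-unique) (there x∈xs) =
    ≈-trans (⊕-cong (f≈0 (All.lookup y∉xs x∈xs)) (Σ-single f≈0 xs-unique x∈xs)) (⊕-identityˡ _)

-- Coefficients in ℕ[q] and the expansion over partitions

infixl 6 _+ⁿ_
_+ⁿ_ : ℕ[q] → ℕ[q] → ℕ[q]
[]      +ⁿ g       = g
(a ∷ f) +ⁿ []      = a ∷ f
(a ∷ f) +ⁿ (b ∷ g) = a ℕ.+ b ∷ f +ⁿ g

fromℕ[q]-+ : ∀ f g → fromℕ[q] (f +ⁿ g) ≡ fromℕ[q] f +ₚ fromℕ[q] g
fromℕ[q]-+ []      g       = ≡.refl
fromℕ[q]-+ (a ∷ f) []      = ≡.refl
fromℕ[q]-+ (a ∷ f) (b ∷ g) = cong₂ _∷_ (fromℕ-+ a b) (fromℕ[q]-+ f g)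

-- Multiplication by `q` does not compute to a plain shift: it leaves a zero multiple of `f` and
-- padding zeros, which vanish only coefficientwise.
con-0∷ : ∀ f → con (ℚ.0ℚ ∷ f) ≈ 𝐪 ⊗ con f
con-0∷ f = ≈-trans (con-cong (coeffwise coeffs)) (con-* q f)
  where
  coeff-+ : ∀ f g n → coeff (f +ₚ g) n ≡ coeff f n ℚ.+ coeff g n
  coeff-+ []      g       n       = ≡.sym (ℚₚ.+-identityˡ _)
  coeff-+ (a ∷ f) []      n       = ≡.sym (ℚₚ.+-identityʳ _)
  coeff-+ (a ∷ f) (b ∷ g) zero    = ≡.refl
  coeff-+ (a ∷ f) (b ∷ g) (suc n) = coeff-+ f g n

  coeff-map-* : ∀ a f n → coeff (map (a ℚ.*_) f) n ≡ a ℚ.* coeff f n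
  coeff-map-* a []      n       = ≡.sym (ℚₚ.*-zeroʳ a)
  coeff-map-* a (b ∷ f) zero    = ≡.refl
  coeff-map-* a (b ∷ f) (suc n) = coeff-map-* a f n

  coeff-0 : ∀ n → coeff (ℚ.0ℚ ∷ []) n ≡ ℚ.0ℚ
  coeff-0 zero    = ≡.refl
  coeff-0 (suc n) = ≡.refl

  0f = map (ℚ.0ℚ ℚ.*_) f
  1f = map (ℚ.1ℚ ℚ.*_) f

  coeff-0f : ∀ n → coeff 0f n ≡ ℚ.0ℚ
  coeff-0f n = ≡.trans (coeff-map-* ℚ.0ℚ f n) (ℚₚ.*-zeroˡ (coeff f n))

  coeffs : ∀ n → coeff (ℚ.0ℚ ∷ f) n ≡ coeff (q *ₚ f) n
  coeffs zero    = ≡.sym (≡.trans (coeff-+ 0f (ℚ.0ℚ ∷ 1f +ₚ (ℚ.0ℚ ∷ [])) 0) (cong (ℚ._+ ℚ.0ℚ) (coeff-0f 0)))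
  coeffs (suc n) = ≡.sym (begin
    coeff (q *ₚ f) (suc n)                                      ≡⟨ coeff-+ 0f (ℚ.0ℚ ∷ 1f +ₚ (ℚ.0ℚ ∷ [])) (suc n) ⟩
    coeff 0f (suc n) ℚ.+ coeff (1f +ₚ (ℚ.0ℚ ∷ [])) n            ≡⟨ cong₂ ℚ._+_ (coeff-0f (suc n)) (coeff-+ 1f (ℚ.0ℚ ∷ []) n) ⟩
    ℚ.0ℚ ℚ.+ (coeff 1f n ℚ.+ coeff (ℚ.0ℚ ∷ []) n)               ≡⟨ ℚₚ.+-identityˡ _ ⟩
    coeff 1f n ℚ.+ coeff (ℚ.0ℚ ∷ []) n                          ≡⟨ cong₂ ℚ._+_ (coeff-map-* ℚ.1ℚ f n) (coeff-0 n) ⟩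
    ℚ.1ℚ ℚ.* coeff f n ℚ.+ ℚ.0ℚ                                 ≡⟨ ℚₚ.+-identityʳ _ ⟩
    ℚ.1ℚ ℚ.* coeff f n                                          ≡⟨ ℚₚ.*-identityˡ _ ⟩
    coeff f n                                                   ∎)
    where open ≡.≡-Reasoning

monomialⁿ : ℕ → ℕ[q]
monomialⁿ k = replicate k 0 ++ 1 ∷ []

con-monomialⁿ : ∀ k → con (fromℕ[q] (monomialⁿ k)) ≈ 𝐪 ^ k
con-monomialⁿ zero    = ≈-refl
con-monomialⁿ (suc k) = ≈-trans (con-0∷ (fromℕ[q] (monomialⁿ k))) (⊗-cong ≈-refl (con-monomialⁿ k))

term : (List ℕ → ℕ[q]) → List ℕ → Λ
term P μ = con (fromℕ[q] (P μ)) ⊗ e[ μ ]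

-- Sums add their coefficient functions pointwise. For a monomial the function is concentrated at
-- the sorted parts, which occur exactly once among the partitions; commutativity identifies the two
-- products of `e`.
expansion : ∀ {n F} → EPositive n F → Σ[ P ∈ (List ℕ → ℕ[q]) ] F ≈ sumOver (partitions n) (term P)
expansion (resp F≈G p) with expansion p
... | P , F≈ = P , ≈-trans (≈-sym F≈G) F≈
expansion {n} 0ᵉ = (λ _ → []) , ≈-sym (Σ-zero (All.universal (λ μ → Λᴿ.zeroˡ _) (partitions n)))
expansion {n} (+ᵉ p₁ p₂) with expansion p₁ | expansion p₂
... | P , F≈ | Q , G≈ = (λ μ → P μ +ⁿ Q μ) , ≈-trans (⊕-cong F≈ G≈) (≈-sym (Σ-+ term-+ (partitions n)))
  where
  term-+ : ∀ μ → term (λ ν → P ν +ⁿ Q ν) μ ≈ term P μ ⊕ term Q μ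
  term-+ μ = ≈-trans
    (⊗-cong (≈-trans (Λᴿ.reflexive (cong con (fromℕ[q]-+ (P μ) (Q μ)))) (con-+ (fromℕ[q] (P μ)) (fromℕ[q] (Q μ)))) ≈-refl)
    (⊗-distribʳ _ _ _)
expansion (monomialᵉ k {μ} μ≥1) = P , ≈-sym (begin
  sumOver (partitions (sum μ)) (term P)      ≈⟨ Σ-single off-diagonal (partitions-unique (sum μ)) (sort∈partitions μ≥1) ⟩
  con (fromℕ[q] (P (sort μ))) ⊗ e[ sort μ ]  ≈⟨ ⊗-cong diagonal (e[↭] (sort-↭ μ)) ⟩
  𝐪 ^ k ⊗ e[ μ ]                             ∎)
  where
  open import Relation.Binary.Reasoning.Setoid Λᴿ.setoid
  P : List ℕ → ℕ[q]
  P ν = if does (≡-dec ℕₚ._≟_ ν (sort μ)) then monomialⁿ k else []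

  diagonal : con (fromℕ[q] (P (sort μ))) ≈ 𝐪 ^ k
  diagonal rewrite dec-true (≡-dec ℕₚ._≟_ (sort μ) (sort μ)) ≡.refl = con-monomialⁿ k

  off-diagonal : ∀ {ν} → ν ≢ sort μ → term P ν ≈ 0Λ
  off-diagonal {ν} ν≢ rewrite dec-false (≡-dec ℕₚ._≟_ ν (sort μ)) ν≢ = Λᴿ.zeroˡ _

theorem2p1 : (p : List ℕ) → All (_≥ 1) p →
    Σ[ P ∈ (List ℕ → ℕ[q]) ]
    ((B[ p ]1 ∣q→1+q) ≈ sumΛ (map (λ μ → con (fromℕ[q] (P μ)) ⊗ e[ μ ]) (partitions (sum p))))
theorem2p1 p _ = expansion (shiftᵉ B[ p ]1ᵖ)
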